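{- On infinite pictures (total functions $\mathbb{Z}^2\to\Sigma$ with $\Sigma$ a finite alphabet), coverability is independent from uniform recurrence, from existence of frequencies and from topological entropy, in the following sense: (i) there exist a coverable infinite picture that is uniformly recurrent and a coverable infinite picture that is not uniformly recurrent; (ii) there exist a coverable infinite picture that has uniform frequencies and a coverable infinite picture that does not have uniform frequencies; (iii) there exist a coverable infinite picture with zero topological entropy and a coverable infinite picture with positive topological entropy.
   Context: A block is a finite word indexed by a rectangle. A block $q$ is a cover of an infinite picture $\mathbf{w}$ if every position of $\mathbb{Z}^2$ belongs to some occurrence of $q$ in $\mathbf{w}$; $\mathbf{w}$ is coverable if it has at least one cover. $\mathbf{w}$ is uniformly recurrent if for all $k\in\mathbb{N}$ there exists $\ell\in\mathbb{N}$ such that all $k\times k$-blocks of $\mathbf{w}$ appear in all $\ell\times\ell$-blocks of $\mathbf{w}$. $\mathbf{w}$ has (uniform) frequencies if for every block $u$ of $\mathbf{w}$ the limit $\lim_{n\to\infty}\frac{|\mathbf{w}[(-n,-n)\dots(n,n)]|_u}{n^2}$ exists, where $\mathbf{w}[(-n,-n)\dots(n,n)]$ is the restriction of $\mathbf{w}$ to $\{ -n,\dots,n\}^2$ and $|v|_u$ is the number of occurrences of $u$ in $v$. With $c_{\mathbf{w}}(n,n)$ the number of different $n\times n$-blocks of $\mathbf{w}$, the topological entropy is $H(\mathbf{w})=\lim_{n\to\infty}\frac{\log_{|\Sigma|}c_{\mathbf{w}}(n,n)}{n^2}$. -}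

module Defs where

open import Data.Nat.Base as ℕ using (ℕ; zero; suc; NonZero; NonTrivial)
import Data.Nat.Properties as ℕ
open import Data.Nat.Solver using (module +-*-Solver)
open import Data.Integer.Base as ℤ using (ℤ; +_; -[1+_]; _⊖_)
import Data.Integer.Properties as ℤ
import Data.Integer.Solver as ℤ-Solver
open import Data.Rational.Unnormalised.Base as ℚ
  using (ℚᵘ; mkℚᵘ; 0ℚᵘ; 1ℚᵘ; *<*; ↥_; ↧_; ↧ₙ_)
import Data.Rational.Unnormalised.Properties as ℚ
open import Data.Fin.Base using (Fin; toℕ; fromℕ<)
open import Data.Fin.Properties as Fin using (all?; toℕ<n)
open import Data.Vec.Base using (Vec; lookup; tabulate)
open import Data.Vec.Properties using (lookup∘tabulate)
open import Data.List.Base using (List; length; filter; cartesianProduct; upTo)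
open import Data.List.Membership.Propositional using (_∈_)
open import Data.List.Relation.Unary.Any using (here; there)
open import Data.List.Relation.Unary.Unique.Propositional using (Unique)
open import Data.Product.Base using (Σ-syntax; ∃-syntax; _×_; _,_; proj₁; proj₂)
open import Data.Sum.Base using (_⊎_; inj₁; inj₂)
open import Function.Base using (_∘_; _$_)
open import Function.Bundles using (_⇔_; Equivalence)
open import Relation.Binary.PropositionalEquality
  using (_≡_; refl; sym; trans; cong; cong₂; subst; subst₂; module ≡-Reasoning)
open import Relation.Nullary using (¬_; Dec; yes; no; contradiction)
open import Relation.Nullary.Decidable using (map′)

record ℝ : Set₁ where
  field
    lower upper     : ℚᵘ → Set
    lower-inhabited : ∃[ r ] lower r
    upper-inhabited : ∃[ r ] upper r
    lower-closed    : ∀ {r s} → r ℚ.< s → lower s → lower r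
    upper-closed    : ∀ {r s} → r ℚ.< s → upper r → upper s
    lower-open      : ∀ {r} → lower r → ∃[ s ] r ℚ.< s × lower s
    upper-open      : ∀ {s} → upper s → ∃[ r ] r ℚ.< s × upper r
    disjoint        : ∀ {r} → ¬ (lower r × upper r)
    located         : ∀ {r s} → r ℚ.< s → lower r ⊎ upper s

  lower-resp-≃ : ∀ {r s} → r ℚ.≃ s → lower r → lower s
  lower-resp-≃ r≃s Lr with lower-open Lr
  ... | t , r<t , Lt = lower-closed (ℚ.<-respˡ-≃ r≃s r<t) Lt

  upper-resp-≃ : ∀ {r s} → r ℚ.≃ s → upper r → upper s
  upper-resp-≃ r≃s Ur with upper-open Ur
  ... | t , t<r , Ut = upper-closed (ℚ.<-respʳ-≃ r≃s t<r) Ut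

open ℝ

infix 4 _<ℝ_

_<ℝ_ : ℝ → ℝ → Set
x <ℝ y = ∃[ q ] upper x q × lower y q

fromℚ : ℚᵘ → ℝ
fromℚ q = record
  { lower           = ℚ._< q
  ; upper           = q ℚ.<_
  ; lower-inhabited = q ℚ.- 1ℚᵘ , q-1<q
  ; upper-inhabited = q ℚ.+ 1ℚᵘ , q<q+1
  ; lower-closed    = ℚ.<-trans
  ; upper-closed    = λ r<s q<r → ℚ.<-trans q<r r<s
  ; lower-open      = λ r<q → let m , r<m , m<q = ℚ.<-dense r<q in m , r<m , m<q
  ; upper-open      = λ q<s → let m , q<m , m<s = ℚ.<-dense q<s in m , m<s , q<m
  ; disjoint        = λ (r<q , q<r) → ℚ.<-asym r<q q<r
  ; located         = λ {r} {s} → loc r s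
  }
  where
  q<q+1 : q ℚ.< q ℚ.+ 1ℚᵘ
  q<q+1 = ℚ.<-respˡ-≃ (ℚ.+-identityʳ q) (ℚ.+-monoʳ-< q {0ℚᵘ} {1ℚᵘ} (*<* (ℤ.+<+ ℕ.z<s)))
  q-1<q : q ℚ.- 1ℚᵘ ℚ.< q
  q-1<q = ℚ.<-respʳ-≃ (ℚ.+-identityʳ q) (ℚ.+-monoʳ-< q {ℚ.- 1ℚᵘ} {0ℚᵘ} (*<* ℤ.-<+))
  loc : ∀ r s → r ℚ.< s → r ℚ.< q ⊎ q ℚ.< s
  loc r s r<s with r ℚ.<? q
  ... | yes r<q = inj₁ r<q
  ... | no  r≮q = inj₂ (ℚ.≤-<-trans (ℚ.≮⇒≥ r≮q) r<s)

0ℝ : ℝ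
0ℝ = fromℚ 0ℚᵘ

infixl 6 _+ℚ_
infixl 7 _/ℕ_

_+ℚ_ : ℝ → ℚᵘ → ℝ
x +ℚ ε = record
  { lower           = λ r → lower x (r ℚ.- ε)
  ; upper           = λ r → upper x (r ℚ.- ε)
  ; lower-inhabited = let r , Lr = lower-inhabited x in r ℚ.+ ε , lower-resp-≃ x (back r) Lr
  ; upper-inhabited = let r , Ur = upper-inhabited x in r ℚ.+ ε , upper-resp-≃ x (back r) Ur
  ; lower-closed    = λ r<s → lower-closed x (shift r<s)
  ; upper-closed    = λ r<s → upper-closed x (shift r<s)
  ; lower-open      = λ {r} L → let s , r-ε<s , Ls = lower-open x L in
                        s ℚ.+ ε , ℚ.<-respˡ-≃ (forth r) (ℚ.+-monoˡ-< ε r-ε<s)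
                        , lower-resp-≃ x (back s) Ls
  ; upper-open      = λ {s} U → let r , r<s-ε , Ur = upper-open x U in
                        r ℚ.+ ε , ℚ.<-respʳ-≃ (forth s) (ℚ.+-monoˡ-< ε r<s-ε)
                        , upper-resp-≃ x (back r) Ur
  ; disjoint        = disjoint x
  ; located         = λ r<s → located x (shift r<s)
  }
  where
  shift : ∀ {r s} → r ℚ.< s → r ℚ.- ε ℚ.< s ℚ.- ε
  shift = ℚ.+-monoˡ-< (ℚ.- ε)
  cancel : ∀ r {a b} → a ℚ.+ b ℚ.≃ 0ℚᵘ → r ℚ.≃ (r ℚ.+ a) ℚ.+ b
  cancel r {a} {b} eq = ℚ.≃-sym (ℚ.≃-trans (ℚ.+-assoc r a b)
    (ℚ.≃-trans (ℚ.+-congʳ r eq) (ℚ.+-identityʳ r)))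
  back : ∀ r → r ℚ.≃ (r ℚ.+ ε) ℚ.- ε
  back r = cancel r (ℚ.+-inverseʳ ε)
  forth : ∀ r → (r ℚ.- ε) ℚ.+ ε ℚ.≃ r
  forth r = ℚ.≃-sym (cancel r (ℚ.+-inverseˡ ε))

_/ℕ_ : ℝ → (d : ℕ) .{{_ : NonZero d}} → ℝ
x /ℕ d@(suc d-1) = record
  { lower           = λ r → lower x (r ℚ.* D)
  ; upper           = λ r → upper x (r ℚ.* D)
  ; lower-inhabited = let r , Lr = lower-inhabited x in r ℚ.* D⁻¹ , lower-resp-≃ x (back r) Lr
  ; upper-inhabited = let r , Ur = upper-inhabited x in r ℚ.* D⁻¹ , upper-resp-≃ x (back r) Ur
  ; lower-closed    = λ r<s → lower-closed x (scale r<s)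
  ; upper-closed    = λ r<s → upper-closed x (scale r<s)
  ; lower-open      = λ {r} L → let s , rD<s , Ls = lower-open x L in
                        s ℚ.* D⁻¹ , ℚ.<-respˡ-≃ (forth r) (ℚ.*-monoˡ-<-pos D⁻¹ rD<s)
                        , lower-resp-≃ x (back s) Ls
  ; upper-open      = λ {s} U → let r , r<sD , Ur = upper-open x U in
                        r ℚ.* D⁻¹ , ℚ.<-respʳ-≃ (forth s) (ℚ.*-monoˡ-<-pos D⁻¹ r<sD)
                        , upper-resp-≃ x (back r) Ur
  ; disjoint        = disjoint x
  ; located         = λ r<s → located x (scale r<s)
  }
  where
  D D⁻¹ : ℚᵘ
  D   = + d ℚ./ 1
  D⁻¹ = + 1 ℚ./ d
  D*D⁻¹ : D ℚ.* D⁻¹ ℚ.≃ 1ℚᵘ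
  D*D⁻¹ = ℚ.*-inverseʳ D
  scale : ∀ {r s} → r ℚ.< s → r ℚ.* D ℚ.< s ℚ.* D
  scale = ℚ.*-monoˡ-<-pos D
  cancel : ∀ r {a b} → a ℚ.* b ℚ.≃ 1ℚᵘ → r ℚ.≃ (r ℚ.* a) ℚ.* b
  cancel r {a} {b} eq = ℚ.≃-sym (ℚ.≃-trans (ℚ.*-assoc r a b)
    (ℚ.≃-trans (ℚ.*-congˡ {r} eq) (ℚ.*-identityʳ r)))
  back : ∀ r → r ℚ.≃ (r ℚ.* D⁻¹) ℚ.* D
  back r = cancel r (ℚ.*-inverseˡ D)
  forth : ∀ r → (r ℚ.* D) ℚ.* D⁻¹ ℚ.≃ r
  forth r = ℚ.≃-sym (cancel r D*D⁻¹)

∣_-_∣<_ : ℝ → ℝ → ℚᵘ → Set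
∣ x - y ∣< ε = (x <ℝ y +ℚ ε) × (y <ℝ x +ℚ ε)

-- Indexed by the positive integers, because the terms below are quotients by n².
Sequence : Set₁
Sequence = (n : ℕ) .{{_ : NonZero n}} → ℝ

infix 4 _⟶_

_⟶_ : Sequence → ℝ → Set
a ⟶ l = ∀ ε → 0ℚᵘ ℚ.< ε → ∃[ N ] ∀ n .{{_ : NonZero n}} → N ℕ.≤ n → ∣ a n - l ∣< ε

Convergent : Sequence → Set₁
Convergent a = ∃[ l ] a ⟶ l

_⁺ _⁻ : ℤ → ℕ
(+ n) ⁺    = n
-[1+ n ] ⁺ = 0
(+ n) ⁻    = 0
-[1+ n ] ⁻ = suc n

module Log (b : ℕ) .{{b>1 : NonTrivial b}} (c : ℕ) .{{c≢0 : NonZero c}} where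

  private instance
    b≢0 : NonZero b
    b≢0 = ℕ.nonTrivial⇒nonZero b

  -- p/q < log c iff bᵖ < c^q; the negative part of p is moved to the right.
  Below Above : ℚᵘ → Set
  Below r = b ℕ.^ (↥ r) ⁺ ℕ.< c ℕ.^ ↧ₙ r ℕ.* b ℕ.^ (↥ r) ⁻
  Above r = c ℕ.^ ↧ₙ r ℕ.* b ℕ.^ (↥ r) ⁻ ℕ.< b ℕ.^ (↥ r) ⁺

  private
    ⁺-⁻ : ∀ i → i ≡ + (i ⁺) ℤ.- + (i ⁻)
    ⁺-⁻ (+ n)    = sym (ℤ.+-identityʳ (+ n))
    ⁺-⁻ -[1+ n ] = refl

    ⊖-⁺-⁻ : ∀ m n → m ℕ.+ (m ⊖ n) ⁻ ≡ n ℕ.+ (m ⊖ n) ⁺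
    ⊖-⁺-⁻ m n = ℤ.+-injective $ begin
      + m ℤ.+ + (z ⁻)
        ≡⟨ solve 4 (λ m n a b → m :+ b := (m :- n) :+ (n :+ b)) refl (+ m) (+ n) (+ (z ⁺)) (+ (z ⁻)) ⟩
      (+ m ℤ.- + n) ℤ.+ (+ n ℤ.+ + (z ⁻))
        ≡⟨ cong (ℤ._+ (+ n ℤ.+ + (z ⁻))) (trans (ℤ.m-n≡m⊖n m n) (⁺-⁻ z)) ⟩
      (+ (z ⁺) ℤ.- + (z ⁻)) ℤ.+ (+ n ℤ.+ + (z ⁻))
        ≡⟨ solve 3 (λ n a b → (a :- b) :+ (n :+ b) := n :+ a) refl (+ n) (+ (z ⁺)) (+ (z ⁻)) ⟩
      + n ℤ.+ + (z ⁺) ∎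
      where
      z = m ⊖ n
      open ≡-Reasoning
      open ℤ-Solver.+-*-Solver

    module _ (p n p′ n′ q q′ : ℕ) where
      private
        L R : ℤ
        L = (+ p ℤ.- + n) ℤ.* + q′
        R = (+ p′ ℤ.- + n′) ℤ.* + q
        K : ℤ
        K = + n ℤ.* + q′ ℤ.+ + n′ ℤ.* + q
        open ℤ-Solver.+-*-Solver
        pos-+* : ∀ x y u v → + (x ℕ.* y ℕ.+ u ℕ.* v) ≡ + x ℤ.* + y ℤ.+ + u ℤ.* + v
        pos-+* x y u v = trans (ℤ.pos-+ (x ℕ.* y) (u ℕ.* v)) (cong₂ ℤ._+_ (ℤ.pos-* x y) (ℤ.pos-* u v))
        left : L ℤ.+ K ≡ + (p ℕ.* q′ ℕ.+ n′ ℕ.* q)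
        left = trans
          (solve 5 (λ p n n′ q q′ → (p :- n) :* q′ :+ (n :* q′ :+ n′ :* q) := p :* q′ :+ n′ :* q)
            refl (+ p) (+ n) (+ n′) (+ q) (+ q′))
          (sym (pos-+* p q′ n′ q))
        right : R ℤ.+ K ≡ + (p′ ℕ.* q ℕ.+ n ℕ.* q′)
        right = trans
          (solve 5 (λ p′ n n′ q q′ → (p′ :- n′) :* q :+ (n :* q′ :+ n′ :* q) := p′ :* q :+ n :* q′)
            refl (+ p′) (+ n) (+ n′) (+ q) (+ q′))
          (sym (pos-+* p′ q n q′))

      cross→ : L ℤ.< R → p ℕ.* q′ ℕ.+ n′ ℕ.* q ℕ.< p′ ℕ.* q ℕ.+ n ℕ.* q′
      cross→ L<R = ℤ.drop‿+<+ (subst₂ ℤ._<_ left right (ℤ.+-monoˡ-< K L<R))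

      cross← : p ℕ.* q′ ℕ.+ n′ ℕ.* q ℕ.< p′ ℕ.* q ℕ.+ n ℕ.* q′ → L ℤ.< R
      cross← lt = subst₂ ℤ._<_ (cancel L) (cancel R)
        (ℤ.+-monoˡ-< (ℤ.- K) (subst₂ ℤ._<_ (sym left) (sym right) (ℤ.+<+ lt)))
        where
        cancel : ∀ x → x ℤ.+ K ℤ.- K ≡ x
        cancel x = trans (ℤ.+-assoc x K (ℤ.- K))
          (trans (cong (λ y → x ℤ.+ y) (ℤ.+-inverseʳ K)) (ℤ.+-identityʳ x))

    <⇒cross : ∀ {r s} → r ℚ.< s →
              (↥ r) ⁺ ℕ.* ↧ₙ s ℕ.+ (↥ s) ⁻ ℕ.* ↧ₙ r ℕ.< (↥ s) ⁺ ℕ.* ↧ₙ r ℕ.+ (↥ r) ⁻ ℕ.* ↧ₙ s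
    <⇒cross {r} {s} (*<* lt) =
      cross→ ((↥ r) ⁺) ((↥ r) ⁻) ((↥ s) ⁺) ((↥ s) ⁻) (↧ₙ r) (↧ₙ s)
        (subst₂ (λ x y → x ℤ.* ↧ s ℤ.< y ℤ.* ↧ r) (⁺-⁻ (↥ r)) (⁺-⁻ (↥ s)) lt)

    ^-distribʳ-* : ∀ m n k → (m ℕ.* n) ℕ.^ k ≡ m ℕ.^ k ℕ.* n ℕ.^ k
    ^-distribʳ-* m n zero    = refl
    ^-distribʳ-* m n (suc k) = trans (cong (m ℕ.* n ℕ.*_) (^-distribʳ-* m n k))
      (solve 4 (λ m n x y → m :* n :* (x :* y) := m :* x :* (n :* y)) refl m n (m ℕ.^ k) (n ℕ.^ k))
      where open +-*-Solver

    c^-nonZero : ∀ k → NonZero (c ℕ.^ k)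
    c^-nonZero k = ℕ.m^n≢0 c k

    -- s ≤ log c ≤ r excludes r < s.
    gap : ∀ {r s} → r ℚ.< s → ¬ Below r → ¬ Above s → ∀ {A : Set} → A
    gap {r} {s} r<s ¬Br ¬As = contradiction main
      (ℕ.<⇒≱ (ℕ.^-monoʳ-< b (ℕ.nonTrivial⇒n>1 b) (<⇒cross r<s)))
      where
      q  = ↧ₙ r
      q′ = ↧ₙ s
      p⁺ = (↥ r) ⁺
      p⁻ = (↥ r) ⁻
      s⁺ = (↥ s) ⁺
      s⁻ = (↥ s) ⁻
      C  = c ℕ.^ (q ℕ.* q′)
      hr : C ℕ.* b ℕ.^ (p⁻ ℕ.* q′) ℕ.≤ b ℕ.^ (p⁺ ℕ.* q′)
      hr = subst₂ ℕ._≤_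
        (trans (^-distribʳ-* (c ℕ.^ q) (b ℕ.^ p⁻) q′) (cong₂ ℕ._*_ (ℕ.^-*-assoc c q q′) (ℕ.^-*-assoc b p⁻ q′)))
        (ℕ.^-*-assoc b p⁺ q′)
        (ℕ.^-monoˡ-≤ q′ (ℕ.≮⇒≥ ¬Br))
      hs : b ℕ.^ (s⁺ ℕ.* q) ℕ.≤ C ℕ.* b ℕ.^ (s⁻ ℕ.* q)
      hs = subst₂ ℕ._≤_
        (ℕ.^-*-assoc b s⁺ q)
        (trans (^-distribʳ-* (c ℕ.^ q′) (b ℕ.^ s⁻) q) (cong₂ ℕ._*_
          (trans (ℕ.^-*-assoc c q′ q) (cong (c ℕ.^_) (ℕ.*-comm q′ q))) (ℕ.^-*-assoc b s⁻ q)))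
        (ℕ.^-monoˡ-≤ q (ℕ.≮⇒≥ ¬As))
      main : b ℕ.^ (s⁺ ℕ.* q ℕ.+ p⁻ ℕ.* q′) ℕ.≤ b ℕ.^ (p⁺ ℕ.* q′ ℕ.+ s⁻ ℕ.* q)
      main = ℕ.*-cancelˡ-≤ C {{c^-nonZero (q ℕ.* q′)}} (begin
        C ℕ.* b ℕ.^ (s⁺ ℕ.* q ℕ.+ p⁻ ℕ.* q′)
          ≡⟨ cong (C ℕ.*_) (ℕ.^-distribˡ-+-* b (s⁺ ℕ.* q) (p⁻ ℕ.* q′)) ⟩
        C ℕ.* (b ℕ.^ (s⁺ ℕ.* q) ℕ.* b ℕ.^ (p⁻ ℕ.* q′))
          ≡⟨ solve 3 (λ c x y → c :* (x :* y) := x :* (c :* y)) refl C (b ℕ.^ (s⁺ ℕ.* q)) (b ℕ.^ (p⁻ ℕ.* q′)) ⟩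
        b ℕ.^ (s⁺ ℕ.* q) ℕ.* (C ℕ.* b ℕ.^ (p⁻ ℕ.* q′))
          ≤⟨ ℕ.*-mono-≤ hs hr ⟩
        C ℕ.* b ℕ.^ (s⁻ ℕ.* q) ℕ.* b ℕ.^ (p⁺ ℕ.* q′)
          ≡⟨ solve 3 (λ c x y → c :* x :* y := c :* (y :* x)) refl C (b ℕ.^ (s⁻ ℕ.* q)) (b ℕ.^ (p⁺ ℕ.* q′)) ⟩
        C ℕ.* (b ℕ.^ (p⁺ ℕ.* q′) ℕ.* b ℕ.^ (s⁻ ℕ.* q))
          ≡⟨ cong (C ℕ.*_) (ℕ.^-distribˡ-+-* b (p⁺ ℕ.* q′) (s⁻ ℕ.* q)) ⟨
        C ℕ.* b ℕ.^ (p⁺ ℕ.* q′ ℕ.+ s⁻ ℕ.* q) ∎)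
        where
        open ℕ.≤-Reasoning
        open +-*-Solver

    below? : ∀ r → Dec (Below r)
    below? r = _ ℕ.<? _

    above? : ∀ r → Dec (Above r)
    above? r = _ ℕ.<? _

    archimedean : ∀ x y .{{_ : NonZero x}} → x ℕ.< y → ∀ B → ∃[ k ] B ℕ.* x ℕ.^ suc k ℕ.< y ℕ.^ suc k
    archimedean x y x<y B = k , (begin-strict
      B ℕ.* (x ℕ.* x ℕ.^ k)        ≡⟨ ℕ.*-assoc B x (x ℕ.^ k) ⟨
      k ℕ.* x ℕ.^ k                <⟨ ℕ.*-monoˡ-< (x ℕ.^ k) {{ℕ.m^n≢0 x k}} (ℕ.m<n+m k {x} (ℕ.>-nonZero⁻¹ x)) ⟩
      (x ℕ.+ k) ℕ.* x ℕ.^ k        ≤⟨ bernoulli k ⟩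
      y ℕ.* y ℕ.^ k ∎)
      where
      k = B ℕ.* x
      open ℕ.≤-Reasoning
      open +-*-Solver
      bernoulli : ∀ k → (x ℕ.+ k) ℕ.* x ℕ.^ k ℕ.≤ y ℕ.^ suc k
      bernoulli zero    = ℕ.*-monoˡ-≤ 1 (ℕ.≤-trans (ℕ.≤-reflexive (ℕ.+-identityʳ x)) (ℕ.<⇒≤ x<y))
      bernoulli (suc k) = begin
        (x ℕ.+ suc k) ℕ.* (x ℕ.* z)
          ≡⟨ solve 3 (λ x k z → (x :+ (con 1 :+ k)) :* (x :* z) := x :* ((x :+ k) :* z) :+ x :* z) refl x k z ⟩
        x ℕ.* ((x ℕ.+ k) ℕ.* z) ℕ.+ x ℕ.* z
          ≤⟨ ℕ.+-monoʳ-≤ _ (ℕ.*-monoˡ-≤ z (ℕ.m≤m+n x k)) ⟩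
        x ℕ.* ((x ℕ.+ k) ℕ.* z) ℕ.+ (x ℕ.+ k) ℕ.* z
          ≡⟨ ℕ.+-comm (x ℕ.* ((x ℕ.+ k) ℕ.* z)) _ ⟩
        suc x ℕ.* ((x ℕ.+ k) ℕ.* z)
          ≤⟨ ℕ.*-mono-≤ x<y (bernoulli k) ⟩
        y ℕ.* y ℕ.^ suc k ∎
        where z = x ℕ.^ k

    module _ (m n : ℕ) (Y : ℕ) where
      private
        z = m ⊖ n
        open ≡-Reasoning
        open +-*-Solver
        e₁ : b ℕ.^ m ℕ.* b ℕ.^ (z ⁻) ≡ b ℕ.^ (z ⁺) ℕ.* b ℕ.^ n
        e₁ = begin
          b ℕ.^ m ℕ.* b ℕ.^ (z ⁻)  ≡⟨ ℕ.^-distribˡ-+-* b m (z ⁻) ⟨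
          b ℕ.^ (m ℕ.+ z ⁻)        ≡⟨ cong (b ℕ.^_) (trans (⊖-⁺-⁻ m n) (ℕ.+-comm n (z ⁺))) ⟩
          b ℕ.^ (z ⁺ ℕ.+ n)        ≡⟨ ℕ.^-distribˡ-+-* b (z ⁺) n ⟩
          b ℕ.^ (z ⁺) ℕ.* b ℕ.^ n  ∎
        e₂ : Y ℕ.* b ℕ.^ n ℕ.* b ℕ.^ (z ⁻) ≡ Y ℕ.* b ℕ.^ (z ⁻) ℕ.* b ℕ.^ n
        e₂ = solve 3 (λ y u v → y :* u :* v := y :* v :* u) refl Y (b ℕ.^ n) (b ℕ.^ (z ⁻))

      below-⊖ : b ℕ.^ m ℕ.< Y ℕ.* b ℕ.^ n → b ℕ.^ (z ⁺) ℕ.< Y ℕ.* b ℕ.^ (z ⁻)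
      below-⊖ lt = ℕ.*-cancelʳ-< (b ℕ.^ n) _ _
        (subst₂ ℕ._<_ e₁ e₂ (ℕ.*-monoˡ-< (b ℕ.^ (z ⁻)) {{ℕ.m^n≢0 b (z ⁻)}} lt))

      above-⊖ : Y ℕ.* b ℕ.^ n ℕ.< b ℕ.^ m → Y ℕ.* b ℕ.^ (z ⁻) ℕ.< b ℕ.^ (z ⁺)
      above-⊖ lt = ℕ.*-cancelʳ-< (b ℕ.^ n) _ _
        (subst₂ ℕ._<_ e₂ e₁ (ℕ.*-monoˡ-< (b ℕ.^ (z ⁻)) {{ℕ.m^n≢0 b (z ⁻)}} lt))

    power : ∀ q n k → (c ℕ.^ q ℕ.* b ℕ.^ n) ℕ.^ k ≡ c ℕ.^ (q ℕ.* k) ℕ.* b ℕ.^ (n ℕ.* k)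
    power q n k = trans (^-distribʳ-* (c ℕ.^ q) (b ℕ.^ n) k)
      (cong₂ ℕ._*_ (ℕ.^-*-assoc c q k) (ℕ.^-*-assoc b n k))

    below-open : ∀ {r} → Below r → ∃[ s ] r ℚ.< s × Below s
    below-open {r} Br = z ℚ./ (q ℕ.* k) , *<* r<s ,
      below-⊖ (suc (p ℕ.* k)) (n ℕ.* k) (c ℕ.^ (q ℕ.* k))
        (subst₂ ℕ._<_ (cong (b ℕ.*_) (ℕ.^-*-assoc b p k)) (power q n k) (proj₂ arch))
      where
      p = (↥ r) ⁺
      n = (↥ r) ⁻
      q = ↧ₙ r
      arch = archimedean (b ℕ.^ p) _ {{ℕ.m^n≢0 b p}} Br b
      k = suc (proj₁ arch)
      z = suc (p ℕ.* k) ⊖ n ℕ.* k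
      open +-*-Solver
      lt : p ℕ.* (q ℕ.* k) ℕ.+ n ℕ.* k ℕ.* q ℕ.< suc (p ℕ.* k) ℕ.* q ℕ.+ n ℕ.* (q ℕ.* k)
      lt = subst (p ℕ.* (q ℕ.* k) ℕ.+ n ℕ.* k ℕ.* q ℕ.<_)
        (solve 4 (λ p n q k → q :+ (p :* (q :* k) :+ n :* k :* q) := (con 1 :+ p :* k) :* q :+ n :* (q :* k)) refl p n q k)
        (ℕ.m<n+m _ {q} ℕ.z<s)
      r<s : ↥ r ℤ.* + (q ℕ.* k) ℤ.< z ℤ.* + q
      r<s = subst₂ (λ x y → x ℤ.* + (q ℕ.* k) ℤ.< y ℤ.* + q)
        (sym (⁺-⁻ (↥ r))) (ℤ.m-n≡m⊖n (suc (p ℕ.* k)) (n ℕ.* k))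
        (cross← p n (suc (p ℕ.* k)) (n ℕ.* k) q (q ℕ.* k) lt)

    above-open : ∀ {s} → Above s → ∃[ r ] r ℚ.< s × Above r
    above-open {s} As = z ℚ./ (q ℕ.* k) , *<* r<s ,
      above-⊖ (p ℕ.* k) (suc (n ℕ.* k)) (c ℕ.^ (q ℕ.* k))
        (subst₂ ℕ._<_
          (trans (cong (b ℕ.*_) (power q n k))
            (solve 3 (λ b x y → b :* (x :* y) := x :* (b :* y)) refl b (c ℕ.^ (q ℕ.* k)) (b ℕ.^ (n ℕ.* k))))
          (ℕ.^-*-assoc b p k) (proj₂ arch))
      where
      p = (↥ s) ⁺
      n = (↥ s) ⁻
      q = ↧ₙ s
      arch = archimedean (c ℕ.^ q ℕ.* b ℕ.^ n) _
        {{ℕ.m*n≢0 (c ℕ.^ q) (b ℕ.^ n) {{ℕ.m^n≢0 c q}} {{ℕ.m^n≢0 b n}}}} As b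
      k = suc (proj₁ arch)
      z = p ℕ.* k ⊖ suc (n ℕ.* k)
      open +-*-Solver
      lt : p ℕ.* k ℕ.* q ℕ.+ n ℕ.* (q ℕ.* k) ℕ.< p ℕ.* (q ℕ.* k) ℕ.+ suc (n ℕ.* k) ℕ.* q
      lt = subst (p ℕ.* k ℕ.* q ℕ.+ n ℕ.* (q ℕ.* k) ℕ.<_)
        (solve 4 (λ p n q k → q :+ (p :* k :* q :+ n :* (q :* k)) := p :* (q :* k) :+ (con 1 :+ n :* k) :* q) refl p n q k)
        (ℕ.m<n+m _ {q} ℕ.z<s)
      r<s : z ℤ.* + q ℤ.< ↥ s ℤ.* + (q ℕ.* k)
      r<s = subst₂ (λ x y → x ℤ.* + q ℤ.< y ℤ.* + (q ℕ.* k))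
        (ℤ.m-n≡m⊖n (p ℕ.* k) (suc (n ℕ.* k))) (sym (⁺-⁻ (↥ s)))
        (cross← (p ℕ.* k) (suc (n ℕ.* k)) p n (q ℕ.* k) q lt)

    n<b^n : ∀ n → n ℕ.< b ℕ.^ n
    n<b^n zero    = ℕ.z<s
    n<b^n (suc n) = begin-strict
      suc n             ≤⟨ n<b^n n ⟩
      b ℕ.^ n           <⟨ ℕ.^-monoʳ-< b (ℕ.nonTrivial⇒n>1 b) (ℕ.n<1+n n) ⟩
      b ℕ.^ suc n       ∎
      where open ℕ.≤-Reasoning

    minusOne-below : Below (ℚ.- 1ℚᵘ)
    minusOne-below = ℕ.<-≤-trans (ℕ.nonTrivial⇒n>1 b)
      (subst₂ ℕ._≤_ (ℕ.*-identityˡ b) (sym (cong₂ ℕ._*_ (ℕ.^-identityʳ c) (ℕ.^-identityʳ b)))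
        (ℕ.*-monoˡ-≤ b (ℕ.>-nonZero⁻¹ c)))

    c-above : Above (+ c ℚ./ 1)
    c-above = subst (ℕ._< b ℕ.^ c) (sym (trans (ℕ.*-identityʳ (c ℕ.^ 1)) (ℕ.^-identityʳ c))) (n<b^n c)

  real : ℝ
  real = record
    { lower           = Below
    ; upper           = Above
    ; lower-inhabited = ℚ.- 1ℚᵘ , minusOne-below
    ; upper-inhabited = + c ℚ./ 1 , c-above
    ; lower-closed    = λ {r} {s} r<s Bs → lc r s r<s Bs
    ; upper-closed    = λ {r} {s} r<s Ar → uc r s r<s Ar
    ; lower-open      = λ {r} → below-open {r}
    ; upper-open      = λ {s} → above-open {s}
    ; disjoint        = λ (Br , Ar) → ℕ.<-asym Br Ar
    ; located         = λ {r} {s} → loc r s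
    }
    where
    lc : ∀ r s → r ℚ.< s → Below s → Below r
    lc r s r<s Bs with below? r
    ... | yes Br = Br
    ... | no ¬Br = gap r<s ¬Br (ℕ.<-asym Bs)
    uc : ∀ r s → r ℚ.< s → Above r → Above s
    uc r s r<s Ar with above? s
    ... | yes As = As
    ... | no ¬As = gap r<s (ℕ.<-asym Ar) ¬As
    loc : ∀ r s → r ℚ.< s → Below r ⊎ Above s
    loc r s r<s with below? r | above? s
    ... | yes Br | _      = inj₁ Br
    ... | no _   | yes As = inj₂ As
    ... | no ¬Br | no ¬As = gap r<s ¬Br ¬As

log : (b : ℕ) .{{_ : NonTrivial b}} (c : ℕ) .{{_ : NonZero c}} → ℝ
log b c = Log.real b c

Picture : ℕ → Set
Picture k = ℤ × ℤ → Fin k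

Block : ℕ → ℕ → ℕ → Set
Block k m n = Vec (Vec (Fin k) n) m

infix 30 _[_,_]

_[_,_] : ∀ {k m n} → Block k m n → Fin m → Fin n → Fin k
q [ x , y ] = lookup (lookup q x) y

infixl 6 _⊞_

_⊞_ : ∀ {m n} → ℤ × ℤ → Fin m × Fin n → ℤ × ℤ
(i , j) ⊞ (x , y) = i ℤ.+ + toℕ x , j ℤ.+ + toℕ y

OccursAt : ∀ {k m n} → Block k m n → Picture k → ℤ × ℤ → Set
OccursAt q w o = ∀ x y → w (o ⊞ (x , y)) ≡ q [ x , y ]

_IsBlockOf_ : ∀ {k m n} → Block k m n → Picture k → Set
q IsBlockOf w = ∃[ o ] OccursAt q w o

restrict : ∀ {k} → Picture k → ℤ × ℤ → ∀ m n → Block k m n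
restrict w o m n = tabulate λ x → tabulate λ y → w (o ⊞ (x , y))

inside : ∀ {m M i} → i ℕ.+ m ℕ.≤ M → Fin m → Fin M
inside {i = i} i+m≤M x = fromℕ< (ℕ.<-≤-trans (ℕ.+-monoʳ-< i (toℕ<n x)) i+m≤M)

OccursInBlockAt : ∀ {k m n M N} → Block k m n → Block k M N → ℕ × ℕ → Set
OccursInBlockAt {m = m} {n} {M} {N} u v (i , j) =
  Σ[ p ∈ i ℕ.+ m ℕ.≤ M ] Σ[ q ∈ j ℕ.+ n ℕ.≤ N ]
    ∀ x y → v [ inside {i = i} p x , inside {i = j} q y ] ≡ u [ x , y ]

occursInBlockAt? : ∀ {k m n M N} (u : Block k m n) (v : Block k M N) ij → Dec (OccursInBlockAt u v ij)
occursInBlockAt? {m = m} {n} {M} {N} u v (i , j) with i ℕ.+ m ℕ.≤? M | j ℕ.+ n ℕ.≤? N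
... | no ¬p | _     = no λ (p , _) → ¬p p
... | yes _ | no ¬q = no λ (_ , q , _) → ¬q q
... | yes p | yes q = map′ (λ h → p , q , h)
  (λ (p′ , q′ , h) → subst₂
    (λ p q → ∀ x y → v [ inside {i = i} p x , inside {i = j} q y ] ≡ u [ x , y ])
    (ℕ.≤-irrelevant p′ p) (ℕ.≤-irrelevant q′ q) h)
  (all? λ x → all? λ y → _ Fin.≟ _)

_AppearsIn_ : ∀ {k m n M N} → Block k m n → Block k M N → Set
u AppearsIn v = ∃[ ij ] OccursInBlockAt u v ij

∣_∣[_] : ∀ {k m n M N} → Block k M N → Block k m n → ℕ
∣_∣[_] {M = M} {N} v u =
  length (filter (occursInBlockAt? u v) (cartesianProduct (upTo (suc M)) (upTo (suc N))))

module _ {k : ℕ} where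

  IsCover : ∀ {m n} → Block k m n → Picture k → Set
  IsCover {m} {n} q w =
    ∀ p → ∃[ o ] OccursAt q w o × (Σ[ xy ∈ Fin m × Fin n ] o ⊞ xy ≡ p)

  Coverable : Picture k → Set
  Coverable w = ∃[ m ] ∃[ n ] Σ[ q ∈ Block k m n ] IsCover q w

  UniformlyRecurrent : Picture k → Set
  UniformlyRecurrent w = ∀ s → ∃[ ℓ ]
    ((u : Block k s s) → u IsBlockOf w → (v : Block k ℓ ℓ) → v IsBlockOf w → u AppearsIn v)

  centred : Picture k → (n : ℕ) → Block k (suc (2 ℕ.* n)) (suc (2 ℕ.* n))
  centred w n = restrict w (ℤ.- + n , ℤ.- + n) _ _

  HasFrequencies : Picture k → Set₁
  HasFrequencies w = ∀ {m n} (u : Block k m n) → u IsBlockOf w →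
    Convergent λ N → fromℚ ((+ ∣ centred w N ∣[ u ] ℚ./ N ℕ.^ 2) {{ℕ.m^n≢0 N 2}})

  BlockCount : Picture k → ℕ → ℕ → Set
  BlockCount w n c = Σ[ us ∈ List (Block k n n) ]
    Unique us × (∀ u → u ∈ us ⇔ u IsBlockOf w) × length us ≡ c

  BlockCount-nonZero : ∀ w {n c} → BlockCount w n c → NonZero c
  BlockCount-nonZero w {n} (us , _ , us⇔ , refl) =
    nonEmpty (Equivalence.from (us⇔ (restrict w o n n)) (o , occurs))
    where
    o : ℤ × ℤ
    o = + 0 , + 0
    occurs : OccursAt (restrict w o n n) w o
    occurs x y = sym (trans (cong (λ row → lookup row y) (lookup∘tabulate _ x)) (lookup∘tabulate _ y))
    nonEmpty : ∀ {u : Block k n n} {us} → u ∈ us → NonZero (length us)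
    nonEmpty (here _)  = _
    nonEmpty (there _) = _

  module _ .{{_ : NonTrivial k}} where

    -- The function c witnesses that each block count exists.
    HasEntropy : Picture k → ℝ → Set
    HasEntropy w h = Σ[ c ∈ (ℕ → ℕ) ] Σ[ count ∈ (∀ n → BlockCount w n (c n)) ]
      (λ n → (log k (c n) {{BlockCount-nonZero w (count n)}} /ℕ n ℕ.^ 2) {{ℕ.m^n≢0 n 2}}) ⟶ h

    ZeroEntropy : Picture k → Set
    ZeroEntropy w = HasEntropy w 0ℝ

    PositiveEntropy : Picture k → Set₁
    PositiveEntropy w = ∃[ h ] HasEntropy w h × 0ℝ <ℝ h

{-# OPTIONS --safe #-}
module Submission where

-- The constant picture is coverable, uniformly recurrent, has frequencies and has entropy 0.
-- The other examples are marker pictures: every row is cut into tiles of width 3D, and every tile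
-- carries one marker in one of its first D cells. However the markers are placed, consecutive ones
-- are more than 2D and at most 4D apart, so the block with one marker amid 2D blanks on either side
-- is a cover. With D = 2, let a row i with 1024ᵉ ≤ |i| < 1024ᵉ⁺¹ have period 6 if e is even and
-- have no two markers at distance 6 if e is odd. Two markers at distance 6 are then absent from
-- arbitrarily large squares, and their number in centred squares oscillates. With D = |Σ| and
-- marker positions in which every finite pattern occurs, |Σ|^(n² / 3D + O(n)) blocks of side n
-- occur, so the entropy is 1 / 3D.

open import Defs
open import Data.Nat.Base as ℕ using (ℕ; zero; suc; NonZero; NonTrivial)
import Data.Nat.Properties as ℕ
import Data.Nat.DivMod as ℕ
open import Data.Nat.Divisibility using (divides)
open import Data.Nat.Solver using () renaming (module +-*-Solver to ℕ-Solver)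
open import Data.Integer.Base as ℤ using (ℤ; +_; -[1+_])
import Data.Integer.Properties as ℤ
import Data.Integer.DivMod as ℤ
open import Data.Integer.Solver using () renaming (module +-*-Solver to ℤ-Solver)
open import Data.Rational.Unnormalised.Base as ℚ
  using (ℚᵘ; mkℚᵘ; 0ℚᵘ; *<*; *≤*; *≡*; ↥_; ↧ₙ_)
import Data.Rational.Unnormalised.Properties as ℚ
open import Data.Rational.Unnormalised.Solver using () renaming (module +-*-Solver to ℚ-Solver)
open import Data.Fin.Base as Fin using (Fin; toℕ; fromℕ<)
import Data.Fin.Properties as Fin
open import Data.List.Base using (List; []; _∷_; _++_; length; map; filter; cartesianProduct;
  cartesianProductWith; upTo; allFin; deduplicate)
open import Data.List.Properties using (length-++; length-map; length-upTo; length-tabulate)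
open import Data.List.Membership.Propositional using (_∈_)
open import Data.List.Membership.Propositional.Properties
open import Data.List.Relation.Unary.Any using (here; there)
open import Data.List.Relation.Unary.All as All using ()
open import Data.List.Relation.Unary.AllPairs using ([]; _∷_)
open import Data.List.Relation.Unary.Unique.Propositional using (Unique)
import Data.List.Relation.Unary.Unique.Propositional.Properties as Unique
open import Data.List.Relation.Unary.Unique.DecPropositional.Properties using (deduplicate-!)
open import Data.Product.Base using (∃-syntax; Σ-syntax; _×_; _,_; proj₁; proj₂)
open import Data.Sum.Base using (_⊎_; inj₁; inj₂)
open import Data.Vec.Base as Vec using (Vec; []; _∷_; lookup; tabulate)
import Data.Vec.Properties as Vec
open import Algebra.Properties.AbelianGroup ℤ.+-0-abelianGroup using (∙-cancelʳ)
open import Function.Base using (_∘_; const)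
open import Function.Bundles using (_⇔_; mk⇔; module Equivalence)
open import Relation.Binary.PropositionalEquality hiding ([_])
open import Relation.Nullary using (¬_; contradiction; yes; no)

open ℝ

-- Limits and logarithms

-- A cover of height 1 ties no row to another, and inside a row it only limits the gaps between
-- markers. So a single covering argument serves every choice of marker offsets, and non-recurrence,
-- oscillation and entropy can be built into the offsets freely. The width 3D is chosen because two
-- offsets below D differ by less than D, which keeps every gap strictly between 2D and 4D. For the
-- frequencies, a stripe must outweigh all stripes nearer to row 0: the factor 1024 leaves room for
-- a window 512 times as large as everything below the stripe of odd level. For the entropy, taking
-- D equal to the alphabet size makes the number of marker tables a power of the base of the
-- logarithm. The block counts then lie between two powers of that base, and no logarithm has to be
-- estimated, only exponents compared.

fromℕ : ℕ → ℚᵘ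
fromℕ n = + n ℚ./ 1

n²≢0 : ∀ n .{{_ : NonZero n}} → NonZero (n ℕ.^ 2)
n²≢0 n = ℕ.m^n≢0 n 2

C/n<ε : ∀ C {ε} → 0ℚᵘ ℚ.< ε → ∃[ N ] ∀ n .{{_ : NonZero n}} → N ℕ.≤ n → + C ℚ./ n ℚ.< ε
C/n<ε C {mkℚᵘ (+ zero)   d} (*<* (ℤ.+<+ ()))
C/n<ε C {mkℚᵘ (+ suc e)  d} _ = suc (C ℕ.* suc d) , λ { n@(suc _) N≤n → *<* (subst₂ ℤ._<_
  (ℤ.pos-* C (suc d)) (ℤ.pos-* (suc e) n)
  (ℤ.+<+ (ℕ.<-≤-trans N≤n (ℕ.m≤n*m n (suc e))))) }
C/n<ε C {mkℚᵘ -[1+ _ ]  d} (*<* ())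

p<q+ε⇒p-ε<q : ∀ {p q ε} → p ℚ.< q ℚ.+ ε → p ℚ.- ε ℚ.< q
p<q+ε⇒p-ε<q {p} {q} {ε} lt = ℚ.<-respʳ-≃
  (solve 2 (λ q e → q :+ e :- e := q) ℚ.≃-refl q ε) (ℚ.+-monoˡ-< (ℚ.- ε) lt)
  where open ℚ-Solver

-- Reals are Dedekind cuts, so a bound on `a n` is expressed through its cuts: every rational under
-- the lower bound belongs to the lower cut, and dually. Density of the rationals supplies the
-- witness that each strict inequality requires.
squeeze : (a : Sequence) (l : ℚᵘ) (C : ℕ) →
  (∀ n .{{_ : NonZero n}} {r} → r ℚ.< l ℚ.- + C ℚ./ n → lower (a n) r) →
  (∀ n .{{_ : NonZero n}} {r} → l ℚ.+ + C ℚ./ n ℚ.< r → upper (a n) r) →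
  a ⟶ fromℚ l
squeeze a l C below above ε ε>0 with C/n<ε C ε>0
... | N , small = N , λ n N≤n →
  (let q , lo , hi = ℚ.<-dense (ℚ.+-monoʳ-< l (small n N≤n)) in q , above n lo , p<q+ε⇒p-ε<q hi) ,
  (let q , lo , hi = ℚ.<-dense (l<l+ε-C/n n (small n N≤n)) in
     q , lo , below n (p<q+ε⇒p-ε<q {q} {l ℚ.- + C ℚ./ n} hi))
  where
  open ℚ-Solver
  l<l+ε-C/n : ∀ n .{{_ : NonZero n}} → + C ℚ./ n ℚ.< ε → l ℚ.< (l ℚ.- + C ℚ./ n) ℚ.+ ε
  l<l+ε-C/n n lt = ℚ.<-respˡ-≃ (solve 2 (λ l c → l :- c :+ c := l) ℚ.≃-refl l (+ C ℚ./ n))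
    (ℚ.+-monoʳ-< (l ℚ.- + C ℚ./ n) lt)

n²-positive : ∀ n .{{_ : NonZero n}} → ℚ.Positive (fromℕ (n ℕ.^ 2))
n²-positive n@(suc _) = _

-- An error of order `C * n` becomes C/n after division by n² and vanishes in the limit. The
-- denominators `d` and n² are cleared and the error is added to the larger side, so the last two
-- hypotheses are inequalities between naturals without subtraction.
squeeze-n² : (a : Sequence) (p d C : ℕ) .{{_ : NonZero d}} (lo hi : ℕ → ℕ) →
  (∀ n .{{_ : NonZero n}} {r} → r ℚ.* fromℕ (n ℕ.^ 2) ℚ.< fromℕ (lo n) → lower (a n) r) →
  (∀ n .{{_ : NonZero n}} {r} → fromℕ (hi n) ℚ.< r ℚ.* fromℕ (n ℕ.^ 2) → upper (a n) r) →
  (∀ n .{{_ : NonZero n}} → p ℕ.* n ℕ.^ 2 ℕ.≤ d ℕ.* (lo n ℕ.+ C ℕ.* n)) →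
  (∀ n .{{_ : NonZero n}} → d ℕ.* hi n ℕ.≤ p ℕ.* n ℕ.^ 2 ℕ.+ d ℕ.* (C ℕ.* n)) →
  a ⟶ fromℚ (+ p ℚ./ d)
squeeze-n² a p d@(suc _) C lo hi below above p≤lo hi≤p = squeeze a (+ p ℚ./ d) C
  (λ n {r} r< → below n {r} (ℚ.<-≤-trans (ℚ.*-monoˡ-<-pos _ {{n²-positive n}} r<) (lower≤ n)))
  (λ n {r} <r → above n {r} (ℚ.≤-<-trans (≤upper n) (ℚ.*-monoˡ-<-pos _ {{n²-positive n}} <r)))
  where
  open ℤ-Solver
  p≤lo′ : ∀ n .{{_ : NonZero n}} → + p ℤ.* (+ n ℤ.* + n) ℤ.≤ + d ℤ.* (+ lo n ℤ.+ + C ℤ.* + n)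
  p≤lo′ n = subst₂ ℤ._≤_
    (trans (ℤ.pos-* p _)
      (cong (+ p ℤ.*_) (trans (ℤ.pos-* n _) (cong (λ x → + n ℤ.* + x) (ℕ.*-identityʳ n)))))
    (trans (ℤ.pos-* d _) (cong (λ x → + d ℤ.* (+ lo n ℤ.+ x)) (ℤ.pos-* C n)))
    (ℤ.+≤+ (p≤lo n))
  hi≤p′ : ∀ n .{{_ : NonZero n}} → + d ℤ.* + hi n ℤ.≤ + p ℤ.* (+ n ℤ.* + n) ℤ.+ + d ℤ.* (+ C ℤ.* + n)
  hi≤p′ n = subst₂ ℤ._≤_
    (ℤ.pos-* d _)
    (cong₂ ℤ._+_ (trans (ℤ.pos-* p _)
      (cong (+ p ℤ.*_) (trans (ℤ.pos-* n _) (cong (λ x → + n ℤ.* + x) (ℕ.*-identityʳ n)))))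
      (trans (ℤ.pos-* d _) (cong (+ d ℤ.*_) (ℤ.pos-* C n))))
    (ℤ.+≤+ (hi≤p n))
  pos-square : ∀ n → + (n ℕ.^ 2) ≡ + n ℤ.* + n
  pos-square n = trans (ℤ.pos-* n _) (cong (λ x → + n ℤ.* + x) (ℕ.*-identityʳ n))
  lower≤ : ∀ n .{{_ : NonZero n}} → (+ p ℚ./ d ℚ.- + C ℚ./ n) ℚ.* fromℕ (n ℕ.^ 2) ℚ.≤ fromℕ (lo n)
  lower≤ n@(suc _) = *≤* (begin
    (+ p ℤ.* + n ℤ.+ ℤ.- (+ C) ℤ.* + d) ℤ.* + (n ℕ.^ 2) ℤ.* + 1
      ≡⟨ cong (λ x → (+ p ℤ.* + n ℤ.+ ℤ.- (+ C) ℤ.* + d) ℤ.* x ℤ.* + 1) (pos-square n) ⟩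
    (+ p ℤ.* + n ℤ.+ ℤ.- (+ C) ℤ.* + d) ℤ.* (+ n ℤ.* + n) ℤ.* + 1
      ≡⟨ solve 4 (λ p n c d → (p :* n :+ (:- c) :* d) :* (n :* n) :* con (+ 1) :=
           (p :* (n :* n) :- d :* (c :* n)) :* n) refl (+ p) (+ n) (+ C) (+ d) ⟩
    (+ p ℤ.* (+ n ℤ.* + n) ℤ.- + d ℤ.* (+ C ℤ.* + n)) ℤ.* + n
      ≤⟨ ℤ.*-monoʳ-≤-nonNeg (+ n) (ℤ.+-monoˡ-≤ (ℤ.- (+ d ℤ.* (+ C ℤ.* + n))) (p≤lo′ n)) ⟩
    (+ d ℤ.* (+ lo n ℤ.+ + C ℤ.* + n) ℤ.- + d ℤ.* (+ C ℤ.* + n)) ℤ.* + n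
      ≡⟨ solve 4 (λ l n c d → (d :* (l :+ c :* n) :- d :* (c :* n)) :* n := l :* (d :* n :* con (+ 1)))
           refl (+ lo n) (+ n) (+ C) (+ d) ⟩
    + lo n ℤ.* (+ d ℤ.* + n ℤ.* + 1)
      ≡⟨ cong (λ x → + lo n ℤ.* (x ℤ.* + 1)) (ℤ.pos-* d n) ⟨
    + lo n ℤ.* (+ (d ℕ.* n) ℤ.* + 1)
      ≡⟨ cong (+ lo n ℤ.*_) (ℤ.pos-* (d ℕ.* n) 1) ⟨
    + lo n ℤ.* + (d ℕ.* n ℕ.* 1) ∎)
    where open ℤ.≤-Reasoning
  ≤upper : ∀ n .{{_ : NonZero n}} → fromℕ (hi n) ℚ.≤ (+ p ℚ./ d ℚ.+ + C ℚ./ n) ℚ.* fromℕ (n ℕ.^ 2)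
  ≤upper n@(suc _) = *≤* (begin
    + hi n ℤ.* + (d ℕ.* n ℕ.* 1)
      ≡⟨ cong (+ hi n ℤ.*_) (trans (ℤ.pos-* (d ℕ.* n) 1) (cong (ℤ._* + 1) (ℤ.pos-* d n))) ⟩
    + hi n ℤ.* (+ d ℤ.* + n ℤ.* + 1)
      ≡⟨ solve 3 (λ h n d → h :* (d :* n :* con (+ 1)) := d :* h :* n) refl (+ hi n) (+ n) (+ d) ⟩
    + d ℤ.* + hi n ℤ.* + n
      ≤⟨ ℤ.*-monoʳ-≤-nonNeg (+ n) (hi≤p′ n) ⟩
    (+ p ℤ.* (+ n ℤ.* + n) ℤ.+ + d ℤ.* (+ C ℤ.* + n)) ℤ.* + n
      ≡⟨ solve 4 (λ p n c d → (p :* (n :* n) :+ d :* (c :* n)) :* n :=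
           (p :* n :+ c :* d) :* (n :* n) :* con (+ 1)) refl (+ p) (+ n) (+ C) (+ d) ⟩
    (+ p ℤ.* + n ℤ.+ + C ℤ.* + d) ℤ.* (+ n ℤ.* + n) ℤ.* + 1
      ≡⟨ cong (λ x → (+ p ℤ.* + n ℤ.+ + C ℤ.* + d) ℤ.* x ℤ.* + 1) (pos-square n) ⟨
    (+ p ℤ.* + n ℤ.+ + C ℤ.* + d) ℤ.* + (n ℕ.^ 2) ℤ.* + 1 ∎)
    where open ℤ.≤-Reasoning

lower-/ℕ : ∀ x d .{{_ : NonZero d}} {r} → lower x (r ℚ.* fromℕ d) → lower (x /ℕ d) r
lower-/ℕ x (suc _) L = L

upper-/ℕ : ∀ x d .{{_ : NonZero d}} {r} → upper x (r ℚ.* fromℕ d) → upper (x /ℕ d) r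
upper-/ℕ x (suc _) U = U

module _ (b : ℕ) .{{b>1 : NonTrivial b}} {c : ℕ} .{{c≢0 : NonZero c}} where

  private instance
    b≢0 : NonZero b
    b≢0 = ℕ.nonTrivial⇒nonZero b

  private
    powers : ∀ e (r : ℚᵘ) → (b ℕ.^ e) ℕ.^ ↧ₙ r ℕ.* b ℕ.^ (↥ r) ⁻ ≡ b ℕ.^ (e ℕ.* ↧ₙ r ℕ.+ (↥ r) ⁻)
    powers e r = trans (cong (ℕ._* b ℕ.^ (↥ r) ⁻) (ℕ.^-*-assoc b e (↧ₙ r)))
      (sym (ℕ.^-distribˡ-+-* b (e ℕ.* ↧ₙ r) ((↥ r) ⁻)))

    <-cross : ∀ {e r} → r ℚ.< fromℕ e → (↥ r) ⁺ ℕ.< e ℕ.* ↧ₙ r ℕ.+ (↥ r) ⁻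
    <-cross {e} {mkℚᵘ (+ n) d} (*<* lt) =
      subst₂ ℕ._<_ (ℕ.*-identityʳ n) (sym (ℕ.+-identityʳ _))
        (ℤ.drop‿+<+ (subst₂ ℤ._<_ (sym (ℤ.pos-* n 1)) (sym (ℤ.pos-* e (suc d))) lt))
    <-cross {e} {mkℚᵘ -[1+ n ] d} _ = ℕ.<-≤-trans ℕ.z<s (ℕ.m≤n+m (suc n) (e ℕ.* suc d))

    >-cross : ∀ {e r} → fromℕ e ℚ.< r → e ℕ.* ↧ₙ r ℕ.+ (↥ r) ⁻ ℕ.< (↥ r) ⁺
    >-cross {e} {mkℚᵘ (+ n) d} (*<* lt) =
      subst₂ ℕ._<_ (sym (ℕ.+-identityʳ _)) (ℕ.*-identityʳ n)
        (ℤ.drop‿+<+ (subst₂ ℤ._<_ (sym (ℤ.pos-* e (suc d))) (sym (ℤ.pos-* n 1)) lt))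
    >-cross {zero} {mkℚᵘ -[1+ n ] d} (*<* ())
    >-cross {suc e} {mkℚᵘ -[1+ n ] d} (*<* ())

  -- The cut of `log b c` compares a power of `b` with a power of `c`. Replacing `c` by `b ^ e`
  -- leaves powers of `b` on both sides, so only exponents remain to be compared, and that
  -- comparison is `r < e` cross-multiplied.
  lower-log : ∀ {e} → b ℕ.^ e ℕ.≤ c → ∀ {r} → r ℚ.< fromℕ e → lower (log b c) r
  lower-log {e} b^e≤c {r} r<e = begin-strict
    b ℕ.^ (↥ r) ⁺                              <⟨ ℕ.^-monoʳ-< b (ℕ.nonTrivial⇒n>1 b) (<-cross {e} r<e) ⟩
    b ℕ.^ (e ℕ.* ↧ₙ r ℕ.+ (↥ r) ⁻)             ≡⟨ powers e r ⟨
    (b ℕ.^ e) ℕ.^ ↧ₙ r ℕ.* b ℕ.^ (↥ r) ⁻       ≤⟨ ℕ.*-monoˡ-≤ _ (ℕ.^-monoˡ-≤ (↧ₙ r) b^e≤c) ⟩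
    c ℕ.^ ↧ₙ r ℕ.* b ℕ.^ (↥ r) ⁻               ∎
    where open ℕ.≤-Reasoning

  upper-log : ∀ {e} → c ℕ.≤ b ℕ.^ e → ∀ {r} → fromℕ e ℚ.< r → upper (log b c) r
  upper-log {e} c≤b^e {r} e<r = begin-strict
    c ℕ.^ ↧ₙ r ℕ.* b ℕ.^ (↥ r) ⁻               ≤⟨ ℕ.*-monoˡ-≤ _ (ℕ.^-monoˡ-≤ (↧ₙ r) c≤b^e) ⟩
    (b ℕ.^ e) ℕ.^ ↧ₙ r ℕ.* b ℕ.^ (↥ r) ⁻       ≡⟨ powers e r ⟩
    b ℕ.^ (e ℕ.* ↧ₙ r ℕ.+ (↥ r) ⁻)             <⟨ ℕ.^-monoʳ-< b (ℕ.nonTrivial⇒n>1 b) (>-cross {e} e<r) ⟩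
    b ℕ.^ (↥ r) ⁺                              ∎
    where open ℕ.≤-Reasoning

*-/-cancel : ∀ f d .{{_ : NonZero d}} → fromℕ f ℚ.≃ (+ f ℚ./ d) ℚ.* fromℕ d
*-/-cancel f d@(suc _) = *≡* (begin
  + f ℤ.* + (d ℕ.* 1)   ≡⟨ cong (λ x → + f ℤ.* + x) (ℕ.*-identityʳ d) ⟩
  + f ℤ.* + d           ≡⟨ ℤ.*-identityʳ _ ⟨
  + f ℤ.* + d ℤ.* + 1   ∎)
  where open ≡-Reasoning

frequency : (ℕ → ℕ) → Sequence
frequency f n = fromℚ ((+ f n ℚ./ n ℕ.^ 2) {{n²≢0 n}})

frequency-⟶ : ∀ f p C → (∀ n .{{_ : NonZero n}} → p ℕ.* n ℕ.^ 2 ℕ.≤ f n ℕ.+ C ℕ.* n) →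
              (∀ n .{{_ : NonZero n}} → f n ℕ.≤ p ℕ.* n ℕ.^ 2 ℕ.+ C ℕ.* n) → frequency f ⟶ fromℚ (fromℕ p)
frequency-⟶ f p C lo hi = squeeze-n² (frequency f) p 1 C f f
  (λ n lt → ℚ.*-cancelʳ-<-nonNeg (fromℕ (n ℕ.^ 2)) (ℚ.<-respʳ-≃ (*-/-cancel (f n) (n ℕ.^ 2) {{n²≢0 n}}) lt))
  (λ n lt → ℚ.*-cancelʳ-<-nonNeg (fromℕ (n ℕ.^ 2)) (ℚ.<-respˡ-≃ (*-/-cancel (f n) (n ℕ.^ 2) {{n²≢0 n}}) lt))
  (λ n → subst (p ℕ.* n ℕ.^ 2 ℕ.≤_) (sym (ℕ.*-identityˡ _)) (lo n))
  (λ n → subst₂ ℕ._≤_ (sym (ℕ.*-identityˡ _)) (cong (p ℕ.* n ℕ.^ 2 ℕ.+_) (sym (ℕ.*-identityˡ _))) (hi n))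

-- A limit closer than `ε` to a term at or above `p + ε` exceeds `p`; closer than `ε` to a term at
-- or below `p - ε`, it lies under `p`. Then `p` would be in both cuts.
oscillating⇒¬Convergent : ∀ f {p ε} → 0ℚᵘ ℚ.< ε →
  (∀ N → ∃[ n ] N ℕ.≤ n × (p ℚ.+ ε) ℚ.* fromℕ (n ℕ.^ 2) ℚ.≤ fromℕ (f n)) →
  (∀ N → ∃[ n ] N ℕ.≤ n × fromℕ (f n) ℚ.≤ (p ℚ.- ε) ℚ.* fromℕ (n ℕ.^ 2)) →
  ¬ Convergent (frequency f)
oscillating⇒¬Convergent f {p} {ε} ε>0 high low (l , f⟶l) with f⟶l ε ε>0
-- Asking for indices from `suc N` on makes them nonzero, so that the quotients by n² are defined.
... | N , close with high (suc N) | low (suc N)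
... | m@(suc _) , N<m , high-m | n@(suc _) , N<n , low-n
  with proj₁ (close m (ℕ.<⇒≤ N<m)) | proj₂ (close n (ℕ.<⇒≤ N<n))
... | q , a<q , Lq | r , Ur , r-ε<a = disjoint l (lower-closed l p<q-ε Lq , upper-closed l r<p Ur)
  where
  open ℚ-Solver
  p+ε<q : p ℚ.+ ε ℚ.< q
  p+ε<q = ℚ.≤-<-trans (ℚ.*-cancelʳ-≤-pos (fromℕ (m ℕ.^ 2)) {{n²-positive m}}
    (ℚ.≤-respʳ-≃ (*-/-cancel (f m) (m ℕ.^ 2)) high-m)) a<q
  p<q-ε : p ℚ.< q ℚ.- ε
  p<q-ε = ℚ.<-respˡ-≃ (solve 2 (λ p e → p :+ e :- e := p) ℚ.≃-refl p ε) (ℚ.+-monoˡ-< (ℚ.- ε) p+ε<q)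
  r-ε<p-ε : r ℚ.- ε ℚ.< p ℚ.- ε
  r-ε<p-ε = ℚ.<-≤-trans r-ε<a (ℚ.*-cancelʳ-≤-pos (fromℕ (n ℕ.^ 2)) {{n²-positive n}}
    (ℚ.≤-respˡ-≃ (*-/-cancel (f n) (n ℕ.^ 2)) low-n))
  r<p : r ℚ.< p
  r<p = ℚ.<-respʳ-≃ (solve 2 (λ p e → p :- e :+ e := p) ℚ.≃-refl p ε)
    (ℚ.<-respˡ-≃ (solve 2 (λ r e → r :- e :+ e := r) ℚ.≃-refl r ε) (ℚ.+-monoˡ-< ε r-ε<p-ε))

-- Counting

module _ {A : Set} where

  -- Pigeonhole: delete one occurrence of the head from `ys`. The tail is still contained in what
  -- remains, because the head does not recur in it.
  Unique⇒length-mono : ∀ {xs ys : List A} → Unique xs → (∀ {x} → x ∈ xs → x ∈ ys) →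
                       length xs ℕ.≤ length ys
  Unique⇒length-mono {[]}     {ys} _            _  = ℕ.z≤n
  Unique⇒length-mono {x ∷ xs} {ys} (x∉xs ∷ xs!) ⊆ys with ∈-∃++ (⊆ys (here refl))
  ... | us , vs , refl = begin
    suc (length xs)                   ≤⟨ ℕ.s≤s (Unique⇒length-mono xs! ⊆us++vs) ⟩
    suc (length (us ++ vs))           ≡⟨ cong suc (length-++ us) ⟩
    suc (length us ℕ.+ length vs)     ≡⟨ ℕ.+-suc (length us) (length vs) ⟨
    length us ℕ.+ suc (length vs)     ≡⟨ length-++ us ⟨
    length (us ++ x ∷ vs)             ∎
    where
    open ℕ.≤-Reasoning
    ⊆us++vs : ∀ {y} → y ∈ xs → y ∈ us ++ vs
    ⊆us++vs y∈xs with ∈-++⁻ us (⊆ys (there y∈xs))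
    ... | inj₁ y∈us           = ∈-++⁺ˡ y∈us
    ... | inj₂ (here refl)    = contradiction refl (All.lookup x∉xs y∈xs)
    ... | inj₂ (there y∈vs)   = ∈-++⁺ʳ us y∈vs

length-cartesianProductWith : ∀ {A B C : Set} (f : A → B → C) xs ys →
  length (cartesianProductWith f xs ys) ≡ length xs ℕ.* length ys
length-cartesianProductWith f []       ys = refl
length-cartesianProductWith f (x ∷ xs) ys = trans (length-++ (map (f x) ys))
  (cong₂ ℕ._+_ (length-map (f x) ys) (length-cartesianProductWith f xs ys))

allVecs : ∀ {A : Set} → List A → ∀ n → List (Vec A n)
allVecs xs zero    = [] ∷ []
allVecs xs (suc n) = cartesianProductWith _∷_ xs (allVecs xs n)

length-allVecs : ∀ {A : Set} (xs : List A) n → length (allVecs xs n) ≡ length xs ℕ.^ n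
length-allVecs xs zero    = refl
length-allVecs xs (suc n) = trans (length-cartesianProductWith _∷_ xs (allVecs xs n))
  (cong (length xs ℕ.*_) (length-allVecs xs n))

∈-allVecs : ∀ {A : Set} {xs : List A} → (∀ x → x ∈ xs) → ∀ {n} (v : Vec A n) → v ∈ allVecs xs n
∈-allVecs all []      = here refl
∈-allVecs all (x ∷ v) = ∈-cartesianProductWith⁺ _∷_ (all x) (∈-allVecs all v)

allVecs-! : ∀ {A : Set} {xs : List A} → Unique xs → ∀ n → Unique (allVecs xs n)
allVecs-! xs! zero    = All.[] ∷ []
allVecs-! xs! (suc n) = Unique.cartesianProductWith⁺ _∷_ (λ { refl → refl , refl }) xs! (allVecs-! xs! n)

module _ {k : ℕ} where

  block-ext : ∀ {m n} {u v : Block k m n} → (∀ x y → u [ x , y ] ≡ v [ x , y ]) → u ≡ v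
  block-ext {u = u} {v} u≗v = begin
    u                                                    ≡⟨ untab u ⟨
    (tabulate λ x → tabulate λ y → u [ x , y ])
      ≡⟨ Vec.tabulate-cong (λ x → Vec.tabulate-cong (u≗v x)) ⟩
    (tabulate λ x → tabulate λ y → v [ x , y ])          ≡⟨ untab v ⟩
    v                                                    ∎
    where
    open ≡-Reasoning
    untab : ∀ {m n} (u : Block k m n) → (tabulate λ x → tabulate λ y → u [ x , y ]) ≡ u
    untab u = trans (Vec.tabulate-cong (λ x → Vec.tabulate∘lookup (lookup u x))) (Vec.tabulate∘lookup u)

  block-lookup : ∀ {m n} (f : Fin m → Fin n → Fin k) x y →
                 (tabulate λ x → tabulate λ y → f x y) [ x , y ] ≡ f x y
  block-lookup f x y = trans (cong (λ row → lookup row y) (Vec.lookup∘tabulate _ x))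
    (Vec.lookup∘tabulate _ y)

  module _ (w : Picture k) where

    restrict-occurs : ∀ o {m n} → OccursAt (restrict w o m n) w o
    restrict-occurs o x y = sym (block-lookup (λ x y → w (o ⊞ (x , y))) x y)

    restrict-unique : ∀ {o m n} {u : Block k m n} → OccursAt u w o → u ≡ restrict w o m n
    restrict-unique {o} occ = block-ext λ x y → trans (sym (occ x y)) (restrict-occurs o x y)

    restrict-isBlock : ∀ o {m n} → restrict w o m n IsBlockOf w
    restrict-isBlock o = o , restrict-occurs o

    restrict-inside : ∀ {a b m n M N i j} (p : i ℕ.+ m ℕ.≤ M) (q : j ℕ.+ n ℕ.≤ N) x y →
      restrict w (a , b) M N [ inside {i = i} p x , inside {i = j} q y ]
        ≡ w (a ℤ.+ + (i ℕ.+ toℕ x) , b ℤ.+ + (j ℕ.+ toℕ y))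
    restrict-inside {a} {b} {i = i} {j} p q x y = trans
      (sym (restrict-occurs (a , b) (inside {i = i} p x) (inside {i = j} q y)))
      (cong₂ (λ s t → w (a ℤ.+ + s , b ℤ.+ + t)) (Fin.toℕ-fromℕ< _) (Fin.toℕ-fromℕ< _))

  module _ {m n M N : ℕ} {u : Block k m n} {v : Block k M N} where

    private
      hits : List (ℕ × ℕ)
      hits = filter (occursInBlockAt? u v) (cartesianProduct (upTo (suc M)) (upTo (suc N)))

    count-≤ : (ys : List (ℕ × ℕ)) → (∀ ij → OccursInBlockAt u v ij → ij ∈ ys) → ∣ v ∣[ u ] ℕ.≤ length ys
    count-≤ ys occ⇒∈ = Unique⇒length-mono
      (Unique.filter⁺ (occursInBlockAt? u v)
        (Unique.cartesianProduct⁺ (Unique.upTo⁺ (suc M)) (Unique.upTo⁺ (suc N))))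
      (λ {ij} ∈hits → occ⇒∈ ij
        (proj₂ (∈-filter⁻
          (occursInBlockAt? u v) {xs = cartesianProduct (upTo (suc M)) (upTo (suc N))} ∈hits)))

    count-≥ : (ys : List (ℕ × ℕ)) → Unique ys → (∀ {ij} → ij ∈ ys → OccursInBlockAt u v ij) →
              length ys ℕ.≤ ∣ v ∣[ u ]
    count-≥ ys ys! ∈⇒occ = Unique⇒length-mono ys! ⊆hits
      where
      ⊆hits : ∀ {ij} → ij ∈ ys → ij ∈ hits
      ⊆hits {i , j} ij∈ys with ∈⇒occ ij∈ys
      ... | occ@(p , q , _) = ∈-filter⁺ (occursInBlockAt? u v)
        (∈-cartesianProduct⁺ (∈-upTo⁺ (ℕ.s≤s (ℕ.m+n≤o⇒m≤o i p))) (∈-upTo⁺ (ℕ.s≤s (ℕ.m+n≤o⇒m≤o j q)))) occ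

  _≟-block_ : ∀ {m n} (u v : Block k m n) → _
  _≟-block_ = Vec.≡-dec (Vec.≡-dec Fin._≟_)

  module _ .{{_ : NonTrivial k}} where

    entropy : ∀ (w : Picture k) p d C .{{_ : NonZero d}} (lo hi c : ℕ → ℕ) →
      (∀ n → BlockCount w n (c n)) →
      (∀ n → k ℕ.^ lo n ℕ.≤ c n) → (∀ n → c n ℕ.≤ k ℕ.^ hi n) →
      (∀ n .{{_ : NonZero n}} → p ℕ.* n ℕ.^ 2 ℕ.≤ d ℕ.* (lo n ℕ.+ C ℕ.* n)) →
      (∀ n .{{_ : NonZero n}} → d ℕ.* hi n ℕ.≤ p ℕ.* n ℕ.^ 2 ℕ.+ d ℕ.* (C ℕ.* n)) →
      HasEntropy w (fromℚ (+ p ℚ./ d))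
    entropy w p d C lo hi c count k^lo≤c c≤k^hi p≤lo hi≤p = c , count ,
      squeeze-n² (λ n → (log k (c n) {{BlockCount-nonZero w (count n)}} /ℕ n ℕ.^ 2) {{ℕ.m^n≢0 n 2}})
        p d C lo hi
        (λ n {r} → below n r (c n) {{BlockCount-nonZero w (count n)}} (k^lo≤c n))
        (λ n {r} → above n r (c n) {{BlockCount-nonZero w (count n)}} (c≤k^hi n))
        p≤lo hi≤p
      where
      below : ∀ n .{{_ : NonZero n}} r c .{{_ : NonZero c}} {e} → k ℕ.^ e ℕ.≤ c →
              r ℚ.* fromℕ (n ℕ.^ 2) ℚ.< fromℕ e → lower ((log k c /ℕ n ℕ.^ 2) {{ℕ.m^n≢0 n 2}}) r
      below n r c {e} le lt = lower-/ℕ (log k c) (n ℕ.^ 2) {{ℕ.m^n≢0 n 2}} {r}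
        (lower-log k {c} {e} le {r ℚ.* fromℕ (n ℕ.^ 2)} lt)
      above : ∀ n .{{_ : NonZero n}} r c .{{_ : NonZero c}} {e} → c ℕ.≤ k ℕ.^ e →
              fromℕ e ℚ.< r ℚ.* fromℕ (n ℕ.^ 2) → upper ((log k c /ℕ n ℕ.^ 2) {{ℕ.m^n≢0 n 2}}) r
      above n r c {e} le lt = upper-/ℕ (log k c) (n ℕ.^ 2) {{ℕ.m^n≢0 n 2}} {r}
        (upper-log k {c} {e} le {r ℚ.* fromℕ (n ℕ.^ 2)} lt)

    zero-entropy : ∃[ w ] Coverable {k} w × (∀ n → BlockCount w n 1) →
      ∃[ w ] Coverable {k} w × ZeroEntropy w
    zero-entropy (w , coverable , count) = w , coverable ,
      entropy w 0 1 0 (const 0) (const 0) (const 1) count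
        (λ _ → ℕ.≤-refl) (λ _ → ℕ.≤-refl) (λ _ → ℕ.z≤n) (λ _ → ℕ.z≤n)

-- The constant picture

-- An m × n block fits at (2N + 2 − m)(2N + 2 − n) positions of the window of side 2N + 1.
window-≥ : ∀ N m n {c} → 1 ℕ.≤ N → (2 ℕ.+ 2 ℕ.* N ℕ.∸ m) ℕ.* (2 ℕ.+ 2 ℕ.* N ℕ.∸ n) ℕ.≤ c →
           4 ℕ.* N ℕ.^ 2 ℕ.≤ c ℕ.+ (12 ℕ.+ (4 ℕ.* m ℕ.+ 2 ℕ.* n)) ℕ.* N
window-≥ N m n {c} 1≤N AB≤c = begin
  4 ℕ.* N ℕ.^ 2
    ≡⟨ solve 1 (λ N → con 4 :* (N :* (N :* con 1)) := (con 2 :* N) :* (con 2 :* N)) refl N ⟩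
  2 ℕ.* N ℕ.* (2 ℕ.* N)
    ≤⟨ split (2 ℕ.+ 2 ℕ.* N ℕ.∸ m) (2 ℕ.+ 2 ℕ.* N ℕ.∸ n) (2N≤ m) (2N≤ n) B≤4N ⟩
  (2 ℕ.+ 2 ℕ.* N ℕ.∸ m) ℕ.* (2 ℕ.+ 2 ℕ.* N ℕ.∸ n) ℕ.+ (4 ℕ.* m ℕ.+ 2 ℕ.* n) ℕ.* N
    ≤⟨ ℕ.+-mono-≤ AB≤c (ℕ.*-monoˡ-≤ N (ℕ.m≤n+m (4 ℕ.* m ℕ.+ 2 ℕ.* n) 12)) ⟩
  c ℕ.+ (12 ℕ.+ (4 ℕ.* m ℕ.+ 2 ℕ.* n)) ℕ.* N ∎
  where
  open ℕ.≤-Reasoning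
  open ℕ-Solver
  2N≤ : ∀ s → 2 ℕ.* N ℕ.≤ (2 ℕ.+ 2 ℕ.* N ℕ.∸ s) ℕ.+ s
  2N≤ s = ℕ.≤-trans (ℕ.m≤n+m (2 ℕ.* N) 2)
    (ℕ.≤-trans (ℕ.m≤n+m∸n (2 ℕ.+ 2 ℕ.* N) s) (ℕ.≤-reflexive (ℕ.+-comm s _)))
  B≤4N : 2 ℕ.+ 2 ℕ.* N ℕ.∸ n ℕ.≤ 4 ℕ.* N
  B≤4N = ℕ.≤-trans (ℕ.m∸n≤m (2 ℕ.+ 2 ℕ.* N) n) (ℕ.≤-trans (ℕ.+-monoˡ-≤ (2 ℕ.* N) (ℕ.*-monoʳ-≤ 2 1≤N))
    (ℕ.≤-reflexive (solve 1 (λ N → con 2 :* N :+ con 2 :* N := con 4 :* N) refl N)))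
  -- The square of side 2N exceeds the A × B rectangle by at most two strips, of areas `m * B` and
  -- `2 * N * n`. The bound on `B` makes both linear in `N`.
  split : ∀ A B → 2 ℕ.* N ℕ.≤ A ℕ.+ m → 2 ℕ.* N ℕ.≤ B ℕ.+ n → B ℕ.≤ 4 ℕ.* N →
          2 ℕ.* N ℕ.* (2 ℕ.* N) ℕ.≤ A ℕ.* B ℕ.+ (4 ℕ.* m ℕ.+ 2 ℕ.* n) ℕ.* N
  split A B ≤A ≤B B≤ = begin
    2 ℕ.* N ℕ.* (2 ℕ.* N)
      ≤⟨ ℕ.*-monoʳ-≤ (2 ℕ.* N) ≤B ⟩
    2 ℕ.* N ℕ.* (B ℕ.+ n)
      ≡⟨ ℕ.*-distribˡ-+ (2 ℕ.* N) B n ⟩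
    2 ℕ.* N ℕ.* B ℕ.+ 2 ℕ.* N ℕ.* n
      ≤⟨ ℕ.+-monoˡ-≤ (2 ℕ.* N ℕ.* n) (ℕ.*-monoˡ-≤ B ≤A) ⟩
    (A ℕ.+ m) ℕ.* B ℕ.+ 2 ℕ.* N ℕ.* n
      ≡⟨ solve 5 (λ N a b m n → (a :+ m) :* b :+ con 2 :* N :* n :=
           a :* b :+ (m :* b :+ con 2 :* N :* n)) refl N A B m n ⟩
    A ℕ.* B ℕ.+ (m ℕ.* B ℕ.+ 2 ℕ.* N ℕ.* n)
      ≤⟨ ℕ.+-monoʳ-≤ (A ℕ.* B) (ℕ.+-monoˡ-≤ (2 ℕ.* N ℕ.* n) (ℕ.*-monoʳ-≤ m B≤)) ⟩
    A ℕ.* B ℕ.+ (m ℕ.* (4 ℕ.* N) ℕ.+ 2 ℕ.* N ℕ.* n)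
      ≡⟨ cong (A ℕ.* B ℕ.+_)
           (solve 3 (λ N m n → m :* (con 4 :* N) :+ con 2 :* N :* n := (con 4 :* m :+ con 2 :* n) :* N)
             refl N m n) ⟩
    A ℕ.* B ℕ.+ (4 ℕ.* m ℕ.+ 2 ℕ.* n) ℕ.* N ∎

-- The left side is the number of corners that `∣_∣[_]` scans in a window of side 2N + 1, each
-- coordinate running from 0 to 2N + 1. Its excess 8N + 4 over 4N² is at most 12N; this is the
-- origin of the 12 in the error constant shared with `window-≥`.
window-≤ : ∀ N m n → 1 ℕ.≤ N →
           (2 ℕ.+ 2 ℕ.* N) ℕ.* (2 ℕ.+ 2 ℕ.* N) ℕ.≤ 4 ℕ.* N ℕ.^ 2 ℕ.+ (12 ℕ.+ (4 ℕ.* m ℕ.+ 2 ℕ.* n)) ℕ.* N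
window-≤ N m n 1≤N = begin
  (2 ℕ.+ 2 ℕ.* N) ℕ.* (2 ℕ.+ 2 ℕ.* N)
    ≡⟨ solve 1 (λ N → (con 2 :+ con 2 :* N) :* (con 2 :+ con 2 :* N) :=
         con 4 :* (N :* (N :* con 1)) :+ (con 8 :* N :+ con 4)) refl N ⟩
  4 ℕ.* N ℕ.^ 2 ℕ.+ (8 ℕ.* N ℕ.+ 4)
    ≤⟨ ℕ.+-monoʳ-≤ (4 ℕ.* N ℕ.^ 2) (ℕ.+-monoʳ-≤ (8 ℕ.* N) (ℕ.*-monoʳ-≤ 4 1≤N)) ⟩
  4 ℕ.* N ℕ.^ 2 ℕ.+ (8 ℕ.* N ℕ.+ 4 ℕ.* N)
    ≡⟨ cong (4 ℕ.* N ℕ.^ 2 ℕ.+_) (ℕ.*-distribʳ-+ N 8 4) ⟨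
  4 ℕ.* N ℕ.^ 2 ℕ.+ 12 ℕ.* N
    ≤⟨ ℕ.+-monoʳ-≤ (4 ℕ.* N ℕ.^ 2) (ℕ.*-monoˡ-≤ N (ℕ.m≤m+n 12 (4 ℕ.* m ℕ.+ 2 ℕ.* n))) ⟩
  4 ℕ.* N ℕ.^ 2 ℕ.+ (12 ℕ.+ (4 ℕ.* m ℕ.+ 2 ℕ.* n)) ℕ.* N ∎
  where
  open ℕ.≤-Reasoning
  open ℕ-Solver

module Constant {k : ℕ} (c : Fin k) where

  w : Picture k
  w _ = c

  coverable : Coverable w
  coverable = 1 , 1 , (c ∷ []) ∷ [] ,
    λ p → p , (λ { Fin.zero Fin.zero → refl }) , (Fin.zero , Fin.zero) ,
      cong₂ _,_ (ℤ.+-identityʳ _) (ℤ.+-identityʳ _)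

  uniformlyRecurrent : UniformlyRecurrent w
  uniformlyRecurrent s = s , λ u (_ , u≡c) v (_ , v≡c) →
    (0 , 0) , ℕ.≤-refl , ℕ.≤-refl , λ x y → trans (sym (v≡c _ _)) (u≡c x y)

  hasFrequencies : HasFrequencies w
  -- The limit is 4 rather than 1 because a window of side 2N + 1 is divided by N².
  hasFrequencies {m} {n} u (_ , u≡c) = fromℚ (fromℕ 4) , frequency-⟶ count 4 C below above
    where
    C = 12 ℕ.+ (4 ℕ.* m ℕ.+ 2 ℕ.* n)
    count : ℕ → ℕ
    count N = ∣ centred w N ∣[ u ]
    module _ (N : ℕ) where
      L : ℕ
      L = suc (2 ℕ.* N)
      corners : List (ℕ × ℕ)
      corners = cartesianProduct (upTo (suc L ℕ.∸ m)) (upTo (suc L ℕ.∸ n))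
      length-corners : length corners ≡ (suc L ℕ.∸ m) ℕ.* (suc L ℕ.∸ n)
      length-corners = trans (length-cartesianProductWith _,_ (upTo (suc L ℕ.∸ m)) (upTo (suc L ℕ.∸ n)))
        (cong₂ ℕ._*_ (length-upTo (suc L ℕ.∸ m)) (length-upTo (suc L ℕ.∸ n)))
      fits : ∀ {s i} → i ∈ upTo (suc L ℕ.∸ s) → i ℕ.+ s ℕ.≤ L
      fits {s} {i} i∈ = ℕ.≤-pred (ℕ.m≤o∸n⇒m+n≤o (suc i) (ℕ.<⇒≤ s<suc-L) (∈-upTo⁻ i∈))
        where
        s<suc-L : s ℕ.< suc L
        s<suc-L = ℕ.m∸n≢0⇒n<m λ eq → ℕ.n≮0 (subst (i ℕ.<_) eq (∈-upTo⁻ i∈))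
      corners≤count : (suc L ℕ.∸ m) ℕ.* (suc L ℕ.∸ n) ℕ.≤ count N
      corners≤count = subst (ℕ._≤ count N) length-corners (count-≥ {u = u} {centred w N} corners
        (Unique.cartesianProduct⁺ (Unique.upTo⁺ (suc L ℕ.∸ m)) (Unique.upTo⁺ (suc L ℕ.∸ n)))
        λ {(i , j)} ij∈ → let i∈ , j∈ = ∈-cartesianProduct⁻ (upTo (suc L ℕ.∸ m)) (upTo (suc L ℕ.∸ n)) ij∈ in
          fits i∈ , fits j∈ , λ x y → trans
            (restrict-inside w {a = ℤ.- + N} {ℤ.- + N} {i = i} {j} (fits i∈) (fits j∈) x y) (u≡c x y))
    below : ∀ N .{{_ : NonZero N}} → 4 ℕ.* N ℕ.^ 2 ℕ.≤ count N ℕ.+ C ℕ.* N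
    below N = window-≥ N m n (ℕ.>-nonZero⁻¹ N) (corners≤count N)
    above : ∀ N .{{_ : NonZero N}} → count N ℕ.≤ 4 ℕ.* N ℕ.^ 2 ℕ.+ C ℕ.* N
    above N = ℕ.≤-trans
      (count-≤ {u = u} {centred w N} (cartesianProduct (upTo (suc (L N))) (upTo (suc (L N))))
        (λ (i , j) (p , q , _) → ∈-cartesianProduct⁺ (∈-upTo⁺ (ℕ.s≤s (ℕ.m+n≤o⇒m≤o i p)))
          (∈-upTo⁺ (ℕ.s≤s (ℕ.m+n≤o⇒m≤o j q)))))
      (subst (ℕ._≤ 4 ℕ.* N ℕ.^ 2 ℕ.+ C ℕ.* N)
        (sym (trans (length-cartesianProductWith _,_ (upTo (suc (L N))) (upTo (suc (L N))))
          (cong₂ ℕ._*_ (length-upTo (suc (L N))) (length-upTo (suc (L N))))))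
        (window-≤ N m n (ℕ.>-nonZero⁻¹ N)))

  blockCount : ∀ n → BlockCount w n 1
  blockCount n = restrict w (+ 0 , + 0) n n ∷ [] , All.[] ∷ [] ,
    (λ u → mk⇔ (λ { (here refl) → restrict-isBlock w (+ 0 , + 0) })
               (λ (o , occ) → here (restrict-unique w {o} occ))) , refl

-- Marker pictures

module _ (d : ℕ) .{{_ : NonZero d}} where

  -- Both `m` and the quotient are some q with q * d ≤ j < (q + 1) * d. Comparing the lower end for
  -- one with the upper end for the other, in both ways, gives the two inequalities.
  /ℕ-unique : ∀ m {r} → r ℕ.< d → (+ r ℤ.+ m ℤ.* + d) ℤ./ℕ d ≡ m
  /ℕ-unique m {r} r<d = ℤ.≤-antisym
    (≤-from (ℤ.≤-<-trans (ℤ.[n/ℕd]*d≤n j d)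
      (subst (j ℤ.<_) (sym (ℤ.suc-* m (+ d))) (ℤ.+-monoˡ-< (m ℤ.* + d) (ℤ.+<+ r<d)))))
    (≤-from (ℤ.≤-<-trans (ℤ.i≤j+i (m ℤ.* + d) (+ r)) (ℤ.n<s[n/ℕd]*d j d)))
    where
    j = + r ℤ.+ m ℤ.* + d
    ≤-from : ∀ {a b} → a ℤ.* + d ℤ.< ℤ.suc b ℤ.* + d → a ℤ.≤ b
    ≤-from {a} {b} lt = subst (a ℤ.≤_) (ℤ.pred-suc b)
      (ℤ.i<j⇒i≤pred[j] {a} {ℤ.suc b} (ℤ.*-cancelʳ-<-nonNeg {a} {ℤ.suc b} (+ d) lt))

  %ℕ-unique : ∀ m {r} → r ℕ.< d → (+ r ℤ.+ m ℤ.* + d) ℤ.%ℕ d ≡ r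
  %ℕ-unique m {r} r<d = ℤ.+-injective (∙-cancelʳ (m ℤ.* + d) _ _ (begin
    + (j ℤ.%ℕ d) ℤ.+ m ℤ.* + d             ≡⟨ cong (λ q → + (j ℤ.%ℕ d) ℤ.+ q ℤ.* + d) (/ℕ-unique m r<d) ⟨
    + (j ℤ.%ℕ d) ℤ.+ (j ℤ./ℕ d) ℤ.* + d    ≡⟨ ℤ.a≡a%ℕn+[a/ℕn]*n j d ⟨
    + r ℤ.+ m ℤ.* + d                      ∎))
    where
    open ≡-Reasoning
    j = + r ℤ.+ m ℤ.* + d

  private
    carry : ∀ m s → + s ℤ.+ m ℤ.* + d ≡ + (s ℕ.% d) ℤ.+ (m ℤ.+ + (s ℕ./ d)) ℤ.* + d
    carry m s = begin
      + s ℤ.+ m ℤ.* + d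
        ≡⟨ cong (ℤ._+ m ℤ.* + d) (ℤ.a≡a%ℕn+[a/ℕn]*n (+ s) d) ⟩
      + (s ℕ.% d) ℤ.+ + (s ℕ./ d) ℤ.* + d ℤ.+ m ℤ.* + d
        ≡⟨ solve 4 (λ r q m d → r :+ q :* d :+ m :* d := r :+ (m :+ q) :* d) refl (+ (s ℕ.% d))
             (+ (s ℕ./ d)) m (+ d) ⟩
      + (s ℕ.% d) ℤ.+ (m ℤ.+ + (s ℕ./ d)) ℤ.* + d ∎
      where
      open ≡-Reasoning
      open ℤ-Solver

  [s+m*d]/ℕd : ∀ m s → (+ s ℤ.+ m ℤ.* + d) ℤ./ℕ d ≡ m ℤ.+ + (s ℕ./ d)
  [s+m*d]/ℕd m s = trans (cong (ℤ._/ℕ d) (carry m s)) (/ℕ-unique (m ℤ.+ + (s ℕ./ d)) (ℕ.m%n<n s d))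

  [s+m*d]%ℕd : ∀ m s → (+ s ℤ.+ m ℤ.* + d) ℤ.%ℕ d ≡ s ℕ.% d
  [s+m*d]%ℕd m s = trans (cong (ℤ._%ℕ d) (carry m s)) (%ℕ-unique (m ℤ.+ + (s ℕ./ d)) (ℕ.m%n<n s d))

module _ {k : ℕ} where

  -- A Kronecker delta with values in the alphabet: the letter 1 is the marker, the letter 0 is the
  -- blank.
  letter : ℕ → ℕ → Fin (2 ℕ.+ k)
  letter r s with r ℕ.≟ s
  ... | yes _ = Fin.suc Fin.zero
  ... | no  _ = Fin.zero

  letter-refl : ∀ r → letter r r ≡ Fin.suc Fin.zero
  letter-refl r with r ℕ.≟ r
  ... | yes _   = refl
  ... | no  r≢r = contradiction refl r≢r

  letter-≢ : ∀ {r s} → r ≢ s → letter r s ≡ Fin.zero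
  letter-≢ {r} {s} r≢s with r ℕ.≟ s
  ... | yes r≡s = contradiction r≡s r≢s
  ... | no  _   = refl

  letter⁻¹ : ∀ {r s} → letter r s ≡ Fin.suc Fin.zero → r ≡ s
  letter⁻¹ {r} {s} eq with r ℕ.≟ s
  ... | yes r≡s = r≡s
  letter⁻¹ () | no _

  letter-cong : ∀ {r s r′ s′} → (r ≡ s → r′ ≡ s′) → (r′ ≡ s′ → r ≡ s) → letter r s ≡ letter r′ s′
  letter-cong {r} {s} f g with r ℕ.≟ s
  ... | yes r≡s = trans (sym (letter-refl _)) (cong (letter _) (f r≡s))
  ... | no  r≢s = sym (letter-≢ (λ eq → r≢s (g eq)))

-- Row i is cut into tiles of width 3 D; tile m of row i carries a single marker, at offset δ (i , m).
module Marker (k : ℕ) (D : ℕ) .{{_ : NonZero D}} (δ : ℤ × ℤ → Fin D) where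

  P : ℕ
  P = 3 ℕ.* D

  instance
    P≢0 : NonZero P
    P≢0 = ℕ.m*n≢0 3 D

  w : Picture (2 ℕ.+ k)
  w (i , j) = letter (j ℤ.%ℕ P) (toℕ (δ (i , j ℤ./ℕ P)))

  w-at : ∀ i m s → w (i , + s ℤ.+ m ℤ.* + P) ≡ letter (s ℕ.% P) (toℕ (δ (i , m ℤ.+ + (s ℕ./ P))))
  w-at i m s = cong₂ (λ r q → letter r (toℕ (δ (i , q)))) ([s+m*d]%ℕd P m s) ([s+m*d]/ℕd P m s)

  w-at-tile : ∀ i m {r} → r ℕ.< P → w (i , + r ℤ.+ m ℤ.* + P) ≡ letter r (toℕ (δ (i , m)))
  w-at-tile i m r<P = cong₂ (λ r q → letter r (toℕ (δ (i , q)))) (%ℕ-unique P m r<P) (/ℕ-unique P m r<P)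

  private
    q : Block (2 ℕ.+ k) 1 (suc (4 ℕ.* D))
    q = tabulate λ _ → tabulate λ y → letter (toℕ y) (2 ℕ.* D)

    D≤P : D ℕ.≤ P
    D≤P = ℕ.m≤n*m D 3

    next-tile : ∀ m t → + (P ℕ.+ t) ℤ.+ m ℤ.* + P ≡ + t ℤ.+ ℤ.suc m ℤ.* + P
    next-tile m t = trans (cong (ℤ._+ m ℤ.* + P) (ℤ.pos-+ P t))
      (solve 3 (λ p t m → p :+ t :+ m :* p := t :+ (con (+ 1) :+ m) :* p) refl (+ P) (+ t) m)
      where open ℤ-Solver

    module _ (i : ℤ) (m : ℤ) where

      μ : ℕ
      μ = toℕ (δ (i , ℤ.suc m))

      μ<D : μ ℕ.< D
      μ<D = Fin.toℕ<n (δ (i , ℤ.suc m))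

      -- Counted from the start of tile `m`, the marker of the next tile is at 3D + μ. Stepping back
      -- by the 2D blanks in front of it gives D + μ.
      origin : ℤ
      origin = + (D ℕ.+ μ) ℤ.+ m ℤ.* + P

      origin-+ : ∀ y → origin ℤ.+ + y ≡ + (D ℕ.+ μ ℕ.+ y) ℤ.+ m ℤ.* + P
      origin-+ y = trans
        (solve 3 (λ a b c → a :+ b :+ c := a :+ c :+ b) refl (+ (D ℕ.+ μ)) (m ℤ.* + P) (+ y))
        (cong (ℤ._+ m ℤ.* + P) (sym (ℤ.pos-+ (D ℕ.+ μ) y)))
        where open ℤ-Solver

      -- The occurrence starts at an offset of at least D in tile `m`, past the marker of that tile,
      -- and ends before 6D = 2P, hence before the tile after the next. The only marker in range is
      -- the one in tile `suc m`, met at `y = 2D`.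
      row-occurs : ∀ y → y ℕ.≤ 4 ℕ.* D → w (i , origin ℤ.+ + y) ≡ letter y (2 ℕ.* D)
      row-occurs y y≤4D with D ℕ.+ μ ℕ.+ y ℕ.<? P
      ... | yes s<P = trans (cong (λ j → w (i , j)) (origin-+ y))
        (trans (w-at-tile i m s<P) (trans (letter-≢ s≢) (sym (letter-≢ y≢))))
        where
        s≢ : D ℕ.+ μ ℕ.+ y ≢ toℕ (δ (i , m))
        s≢ eq = ℕ.<⇒≱ (Fin.toℕ<n (δ (i , m)))
          (subst (D ℕ.≤_) eq (ℕ.≤-trans (ℕ.m≤m+n D μ) (ℕ.m≤m+n (D ℕ.+ μ) y)))
        y≢ : y ≢ 2 ℕ.* D
        y≢ refl = ℕ.<⇒≱ s<P (ℕ.+-monoˡ-≤ (2 ℕ.* D) (ℕ.m≤m+n D μ))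
      ... | no  s≮P = trans (cong (λ j → w (i , j)) (trans (origin-+ y)
            (trans (cong (λ s → + s ℤ.+ m ℤ.* + P) (sym P+t)) (next-tile m t))))
        (trans (w-at-tile i (ℤ.suc m) t<P) (letter-cong t≡μ⇒y≡2D y≡2D⇒t≡μ))
        where
        t : ℕ
        t = D ℕ.+ μ ℕ.+ y ℕ.∸ P
        P+t : P ℕ.+ t ≡ D ℕ.+ μ ℕ.+ y
        P+t = ℕ.m+[n∸m]≡n (ℕ.≮⇒≥ s≮P)
        open ℕ-Solver
        P+P : D ℕ.+ D ℕ.+ 4 ℕ.* D ≡ P ℕ.+ P
        P+P = solve 1 (λ d → d :+ d :+ con 4 :* d := con 3 :* d :+ con 3 :* d) refl D
        t<P : t ℕ.< P
        t<P = ℕ.+-cancelˡ-< P t P (subst₂ ℕ._<_ (sym P+t) P+P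
          (ℕ.+-mono-<-≤ (ℕ.+-monoʳ-< D μ<D) y≤4D))
        P+x : ∀ x → P ℕ.+ x ≡ D ℕ.+ x ℕ.+ 2 ℕ.* D
        P+x x = solve 2 (λ d x → con 3 :* d :+ x := d :+ x :+ con 2 :* d) refl D x
        t≡μ⇒y≡2D : t ≡ μ → y ≡ 2 ℕ.* D
        t≡μ⇒y≡2D t≡μ = ℕ.+-cancelˡ-≡ (D ℕ.+ μ) y (2 ℕ.* D)
          (trans (sym P+t) (trans (cong (P ℕ.+_) t≡μ) (P+x μ)))
        y≡2D⇒t≡μ : y ≡ 2 ℕ.* D → t ≡ μ
        y≡2D⇒t≡μ y≡2D = ℕ.+-cancelˡ-≡ P t μ (trans P+t (trans (cong (D ℕ.+ μ ℕ.+_) y≡2D) (sym (P+x μ))))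

      q-occurs : OccursAt q w (i , origin)
      q-occurs Fin.zero y = begin
        w (i ℤ.+ + 0 , origin ℤ.+ + toℕ y)  ≡⟨ cong (λ i → w (i , origin ℤ.+ + toℕ y)) (ℤ.+-identityʳ i) ⟩
        w (i , origin ℤ.+ + toℕ y)          ≡⟨ row-occurs (toℕ y) (ℕ.≤-pred (Fin.toℕ<n y)) ⟩
        letter (toℕ y) (2 ℕ.* D)
          ≡⟨ block-lookup (λ _ y → letter (toℕ y) (2 ℕ.* D)) (Fin.zero {0}) y ⟨
        q [ Fin.zero , y ]                  ∎
        where open ≡-Reasoning

      covers : ∀ {j y} → y ℕ.≤ 4 ℕ.* D → + (D ℕ.+ μ ℕ.+ y) ℤ.+ m ℤ.* + P ≡ j →
        ∃[ o ] OccursAt q w o × (Σ[ xy ∈ Fin 1 × Fin (suc (4 ℕ.* D)) ] o ⊞ xy ≡ (i , j))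
      covers {j} {y} y≤4D eq = (i , origin) , q-occurs , (Fin.zero , fromℕ< (ℕ.s≤s y≤4D)) ,
        cong₂ _,_ (ℤ.+-identityʳ i)
          (trans (cong (λ y → origin ℤ.+ + y) (Fin.toℕ-fromℕ< (ℕ.s≤s y≤4D))) (trans (origin-+ y) eq))

  coverable : Coverable w
  coverable = 1 , suc (4 ℕ.* D) , q , cover
    where
    cover : IsCover q w
    -- The occurrence around the tile's own marker extends 2D cells beyond it. A cell further right
    -- has offset above 2D, where the occurrence around the next marker has already begun, since D +
    -- μ < 2D.
    cover (i , j) with j ℤ.%ℕ P ℕ.≤? 2 ℕ.* D ℕ.+ toℕ (δ (i , j ℤ./ℕ P))
    ... | yes r≤ = covers i (ℤ.pred m) {y = y} y≤4D here-eq
      where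
      r = j ℤ.%ℕ P
      m = j ℤ./ℕ P
      μ₀ = toℕ (δ (i , m))
      y = 2 ℕ.* D ℕ.+ r ℕ.∸ μ₀
      μ₀≤ : μ₀ ℕ.≤ 2 ℕ.* D ℕ.+ r
      μ₀≤ = ℕ.≤-trans (ℕ.<⇒≤ (Fin.toℕ<n (δ (i , m)))) (ℕ.≤-trans (ℕ.m≤n*m D 2) (ℕ.m≤m+n (2 ℕ.* D) r))
      open ℕ-Solver
      y≤4D : y ℕ.≤ 4 ℕ.* D
      y≤4D = ℕ.m≤n+o⇒m∸n≤o (2 ℕ.* D ℕ.+ r) μ₀ (ℕ.≤-trans (ℕ.+-monoʳ-≤ (2 ℕ.* D) r≤)
        (ℕ.≤-reflexive (solve 2 (λ d x → con 2 :* d :+ (con 2 :* d :+ x) := x :+ con 4 :* d) refl D μ₀)))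
      D+μ₀+y : D ℕ.+ μ₀ ℕ.+ y ≡ P ℕ.+ r
      D+μ₀+y = trans (ℕ.+-assoc D μ₀ y) (trans (cong (D ℕ.+_) (ℕ.m+[n∸m]≡n μ₀≤))
        (sym (ℕ.+-assoc D (2 ℕ.* D) r)))
      here-eq : + (D ℕ.+ toℕ (δ (i , ℤ.suc (ℤ.pred m))) ℕ.+ y) ℤ.+ ℤ.pred m ℤ.* + P ≡ j
      here-eq = begin
        + (D ℕ.+ toℕ (δ (i , ℤ.suc (ℤ.pred m))) ℕ.+ y) ℤ.+ ℤ.pred m ℤ.* + P
          ≡⟨ cong (λ q → + (D ℕ.+ toℕ (δ (i , q)) ℕ.+ y) ℤ.+ ℤ.pred m ℤ.* + P) (ℤ.suc-pred m) ⟩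
        + (D ℕ.+ μ₀ ℕ.+ y) ℤ.+ ℤ.pred m ℤ.* + P
          ≡⟨ cong (λ s → + s ℤ.+ ℤ.pred m ℤ.* + P) D+μ₀+y ⟩
        + (P ℕ.+ r) ℤ.+ ℤ.pred m ℤ.* + P
          ≡⟨ next-tile (ℤ.pred m) r ⟩
        + r ℤ.+ ℤ.suc (ℤ.pred m) ℤ.* + P
          ≡⟨ cong (λ q → + r ℤ.+ q ℤ.* + P) (ℤ.suc-pred m) ⟩
        + r ℤ.+ m ℤ.* + P
          ≡⟨ ℤ.a≡a%ℕn+[a/ℕn]*n j P ⟨
        j ∎
        where open ≡-Reasoning
    ... | no  r≰ = covers i m {y = y} y≤4D
      (trans (cong (λ s → + s ℤ.+ m ℤ.* + P) (ℕ.m+[n∸m]≡n D+μ≤r)) (sym (ℤ.a≡a%ℕn+[a/ℕn]*n j P)))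
      where
      r = j ℤ.%ℕ P
      m = j ℤ./ℕ P
      y = r ℕ.∸ (D ℕ.+ μ i m)
      y≤4D : y ℕ.≤ 4 ℕ.* D
      y≤4D = ℕ.≤-trans (ℕ.m∸n≤m r (D ℕ.+ μ i m))
        (ℕ.≤-trans (ℕ.<⇒≤ (ℤ.n%ℕd<d j P)) (ℕ.*-monoˡ-≤ D (ℕ.n≤1+n 3)))
      D+μ≤r : D ℕ.+ μ i m ℕ.≤ r
      D+μ≤r = ℕ.≤-trans (ℕ.+-monoʳ-≤ D (ℕ.≤-trans (ℕ.<⇒≤ (μ<D i m)) (ℕ.m≤m+n D 0)))
        (ℕ.≤-trans (ℕ.m≤m+n (2 ℕ.* D) (toℕ (δ (i , m)))) (ℕ.<⇒≤ (ℕ.≰⇒> r≰)))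

-- Stripes of two kinds of rows

module Level (pos : ℕ → ℕ) (pos-mono-< : ∀ {a b} → a ℕ.< b → pos a ℕ.< pos b) where

  -- Counts the values `pos e` with `e ≥ 1` that are at most the argument. For powers of 1024 this
  -- is the integer logarithm, extended by 0 at 0; for squares it is the integer square root.
  level : ℕ → ℕ
  level zero    = 0
  level (suc n) with suc n ℕ.≟ pos (suc (level n))
  ... | yes _ = suc (level n)
  ... | no  _ = level n

  private
    <pos-suc : ∀ n → n ℕ.< pos (suc (level n))
    <pos-suc zero    = ℕ.≤-<-trans ℕ.z≤n (pos-mono-< ℕ.z<s)
    <pos-suc (suc n) with suc n ℕ.≟ pos (suc (level n))
    ... | yes eq = subst (ℕ._< pos (suc (suc (level n)))) (sym eq) (pos-mono-< (ℕ.n<1+n _))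
    ... | no  ≢  = ℕ.≤∧≢⇒< (<pos-suc n) ≢

    -- The first alternative is there for arguments below `pos 0`, such as 0 when `pos 0` is 1024⁰.
    pos≤ : ∀ n → level n ≡ 0 ⊎ pos (level n) ℕ.≤ n
    pos≤ zero    = inj₁ refl
    pos≤ (suc n) with suc n ℕ.≟ pos (suc (level n)) | pos≤ n
    ... | yes eq | _       = inj₂ (ℕ.≤-reflexive (sym eq))
    ... | no  _  | inj₁ eq = inj₁ eq
    ... | no  _  | inj₂ le = inj₂ (ℕ.m≤n⇒m≤1+n le)

    pos-cancel-< : ∀ {a b} → pos a ℕ.< pos b → a ℕ.< b
    pos-cancel-< {a} {b} lt with a ℕ.<? b
    ... | yes a<b = a<b
    ... | no  a≮b with ℕ.m≤n⇒m<n∨m≡n (ℕ.≮⇒≥ a≮b)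
    ...   | inj₁ b<a  = contradiction (pos-mono-< b<a) (ℕ.<-asym lt)
    ...   | inj₂ refl = contradiction lt (ℕ.<-irrefl refl)

  level-unique : ∀ {e n} → pos e ℕ.≤ n → n ℕ.< pos (suc e) → level n ≡ e
  level-unique {e} {n} pos-e≤n n<pos = ℕ.≤-antisym level≤e
    (ℕ.≤-pred (pos-cancel-< (ℕ.≤-<-trans pos-e≤n (<pos-suc n))))
    where
    level≤e : level n ℕ.≤ e
    level≤e with pos≤ n
    ... | inj₁ eq = subst (ℕ._≤ e) (sym eq) ℕ.z≤n
    ... | inj₂ le = ℕ.≤-pred (pos-cancel-< (ℕ.≤-<-trans le n<pos))

flip : Fin 2 → Fin 2
flip Fin.zero           = Fin.suc Fin.zero
flip (Fin.suc Fin.zero) = Fin.zero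

flip-≢ : ∀ x → flip x ≢ x
flip-≢ Fin.zero           ()
flip-≢ (Fin.suc Fin.zero) ()

parity : ℕ → Fin 2
parity zero    = Fin.zero
parity (suc n) = flip (parity n)

parity-even : ∀ e → parity (e ℕ.+ e) ≡ Fin.zero
parity-even zero    = refl
parity-even (suc e) = trans (cong (λ n → flip (parity n)) (ℕ.+-suc e e))
  (cong (λ x → flip (flip x)) (parity-even e))

parity-suc : ∀ m → parity ℤ.∣ ℤ.suc m ∣ ≢ parity ℤ.∣ m ∣
parity-suc (+ n)          = flip-≢ (parity n)
parity-suc -[1+ zero ]    ()
parity-suc -[1+ suc n ] eq = flip-≢ (parity (suc n)) (sym eq)

module Stripes (k : ℕ) where

  open Level (1024 ℕ.^_) (ℕ.^-monoʳ-< 1024 (ℕ.≤ᵇ⇒≤ 2 1024 _))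

  -- In tiles of width 6, a constant offset makes every gap 6, while offsets alternating between 0
  -- and 1 make the gaps alternate between 7 and 5.
  stripe : Fin 2 → ℤ → Fin 2
  stripe Fin.zero    m = Fin.zero
  stripe (Fin.suc _) m = parity ℤ.∣ m ∣

  type : ℤ → Fin 2
  type i = parity (level ℤ.∣ i ∣)

  open Marker k 2 (λ (i , m) → stripe (type i) m) public

  private
    one : Fin (2 ℕ.+ k)
    one = Fin.suc Fin.zero

  periodic : ∀ {i} → type i ≡ Fin.zero → ∀ m s → w (i , + s ℤ.+ m ℤ.* + 6) ≡ letter (s ℕ.% 6) 0
  periodic {i} eq m s = trans (w-at i m s)
    (cong (λ t → letter (s ℕ.% 6) (toℕ (stripe t (m ℤ.+ + (s ℕ./ 6))))) eq)

  -- Markers at j and j + 6 have the same offset in consecutive tiles.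
  gap-6⇒periodic : ∀ {i j} → w (i , j) ≡ one → w (i , j ℤ.+ + 6) ≡ one → type i ≡ Fin.zero
  gap-6⇒periodic {i} {j} at-j at-j+6 = stripe-≡ (type i)
    (Fin.toℕ-injective (trans (sym (letter⁻¹ at-j+6′)) (letter⁻¹ at-j)))
    where
    m = j ℤ./ℕ 6
    stripe-≡ : ∀ t → stripe t (ℤ.suc m) ≡ stripe t m → t ≡ Fin.zero
    stripe-≡ Fin.zero    _  = refl
    stripe-≡ (Fin.suc _) eq = contradiction eq (parity-suc m)
    shift : j ℤ.+ + 6 ≡ + (j ℤ.%ℕ 6) ℤ.+ ℤ.suc m ℤ.* + 6
    shift = trans (cong (ℤ._+ + 6) (ℤ.a≡a%ℕn+[a/ℕn]*n j 6))
      (solve 2 (λ r m → r :+ m :* con (+ 6) :+ con (+ 6) := r :+ (con (+ 1) :+ m) :* con (+ 6)) refl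
        (+ (j ℤ.%ℕ 6)) m)
      where open ℤ-Solver
    at-j+6′ : letter (j ℤ.%ℕ 6) (toℕ (stripe (type i) (ℤ.suc m))) ≡ one
    at-j+6′ = trans (sym (w-at-tile i (ℤ.suc m) (ℤ.n%ℕd<d j 6)))
      (trans (cong (λ j → w (i , j)) (sym shift)) at-j+6)

  type-even : ∀ e {i} → 1024 ℕ.^ (e ℕ.+ e) ℕ.≤ ℤ.∣ i ∣ → ℤ.∣ i ∣ ℕ.< 1024 ℕ.^ suc (e ℕ.+ e) →
    type i ≡ Fin.zero
  type-even e lo hi = trans (cong parity (level-unique {e ℕ.+ e} lo hi)) (parity-even e)

  type-odd : ∀ e {i} → 1024 ℕ.^ suc (e ℕ.+ e) ℕ.≤ ℤ.∣ i ∣ → ℤ.∣ i ∣ ℕ.< 1024 ℕ.^ suc (suc (e ℕ.+ e)) →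
    type i ≢ Fin.zero
  type-odd e lo hi eq with trans (sym eq)
    (trans (cong parity (level-unique {suc (e ℕ.+ e)} lo hi)) (cong flip (parity-even e)))
  ... | ()

  -- Row 0 is periodic, so the first row of u has two markers at distance 6.
  module _ {a : ℕ} where

    u : Block (2 ℕ.+ k) (suc a) 7
    u = restrict w (+ 0 , + 0) (suc a) 7

    u-left : u [ Fin.zero , Fin.zero ] ≡ one
    u-left = sym (restrict-occurs w (+ 0 , + 0) {suc a} {7} Fin.zero Fin.zero)

    u-right : u [ Fin.zero , Fin.fromℕ 6 ] ≡ one
    u-right = sym (restrict-occurs w (+ 0 , + 0) {suc a} {7} Fin.zero (Fin.fromℕ 6))

    occurs⇒periodic : ∀ {M N c d i j} → OccursInBlockAt u (restrict w (c , d) M N) (i , j) →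
      type (c ℤ.+ + i) ≡ Fin.zero
    occurs⇒periodic {M} {N} {c} {d} {i} {j} (p , q , occ) = gap-6⇒periodic {c ℤ.+ + i} {d ℤ.+ + j}
      (trans (cong₂ (λ s t → w (c ℤ.+ + s , d ℤ.+ + t)) (sym (ℕ.+-identityʳ i)) (sym (ℕ.+-identityʳ j)))
        (trans (sym (restrict-inside w {c} {d} {i = i} {j} p q Fin.zero Fin.zero))
          (trans (occ Fin.zero Fin.zero) u-left)))
      (trans (cong₂ (λ s t → w (c ℤ.+ + s , t)) (sym (ℕ.+-identityʳ i))
          (trans (ℤ.+-assoc d (+ j) (+ 6)) (cong (λ x → d ℤ.+ x) (sym (ℤ.pos-+ j 6)))))
        (trans (sym (restrict-inside w {c} {d} {i = i} {j} p q Fin.zero (Fin.fromℕ 6)))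
          (trans (occ Fin.zero (Fin.fromℕ 6)) u-right)))

  private
    1<1024 : 1 ℕ.< 1024
    1<1024 = ℕ.≤ᵇ⇒≤ 2 1024 _

    e≤1024^e : ∀ e → e ℕ.≤ 1024 ℕ.^ e
    e≤1024^e zero    = ℕ.z≤n
    e≤1024^e (suc e) = ℕ.≤-trans (ℕ.s≤s (e≤1024^e e)) (ℕ.^-monoʳ-< 1024 1<1024 (ℕ.n<1+n e))

    1≤1024^e : ∀ e → 1 ℕ.≤ 1024 ℕ.^ e
    1≤1024^e e = ℕ.>-nonZero⁻¹ (1024 ℕ.^ e) {{ℕ.m^n≢0 1024 e}}

    e≤1024^[e+e] : ∀ e → e ℕ.≤ 1024 ℕ.^ (e ℕ.+ e)
    e≤1024^[e+e] e = ℕ.≤-trans (ℕ.m≤m+n e e) (e≤1024^e (e ℕ.+ e))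

  ¬uniformlyRecurrent : ¬ UniformlyRecurrent w
  ¬uniformlyRecurrent recurrent = contradict (proj₁ (recurrent 7)) (proj₂ (recurrent 7))
    where
    module _ (ℓ : ℕ) where
      -- The exponent is odd and large enough for `ℓ ≤ M`, so the rows from M to M + ℓ - 1 stay
      -- below 2M and all belong to one stripe of odd level.
      M = 1024 ℕ.^ suc (ℓ ℕ.+ ℓ)
      v : Block (2 ℕ.+ k) ℓ ℓ
      v = restrict w (+ M , + 0) ℓ ℓ
      ℓ≤M : ℓ ℕ.≤ M
      ℓ≤M = ℕ.≤-trans (e≤1024^[e+e] ℓ) (ℕ.m≤n*m _ 1024)
      M+i< : ∀ {i} → i ℕ.< M → M ℕ.+ i ℕ.< 1024 ℕ.* M
      M+i< {i} i<M = ℕ.<-≤-trans (ℕ.+-monoʳ-< M i<M)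
        (subst (ℕ._≤ 1024 ℕ.* M) (cong (M ℕ.+_) (ℕ.+-identityʳ M)) (ℕ.*-monoˡ-≤ M 1<1024))
      contradict : (∀ (u : Block (2 ℕ.+ k) 7 7) → u IsBlockOf w → ∀ v → v IsBlockOf w → u AppearsIn v) → _
      -- Uniform recurrence speaks of square blocks, so the row of seven cells is extended to height
      -- 7; its first row alone yields the contradiction.
      contradict appears with appears (u {6}) (restrict-isBlock w (+ 0 , + 0)) v
        (restrict-isBlock w (+ M , + 0))
      ... | (i , j) , occ@(p , _) = type-odd ℓ {+ (M ℕ.+ i)} (ℕ.m≤m+n M i)
        (M+i< (ℕ.<-≤-trans (ℕ.m<m+n i ℕ.z<s) (ℕ.≤-trans p ℓ≤M)))
        (occurs⇒periodic {6} {ℓ} {ℓ} {+ M} {+ 0} {i} {j} occ)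

  count : ℕ → ℕ
  count n = ∣ centred w n ∣[ u {0} ]

  private
    -n+[n+x] : ∀ n x → ℤ.- + n ℤ.+ + (n ℕ.+ x) ≡ + x
    -n+[n+x] n x = solve 2 (λ n x → :- n :+ (n :+ x) := x) refl (+ n) (+ x)
      where open ℤ-Solver

    -[i+x]+i : ∀ i x → ℤ.- + (i ℕ.+ x) ℤ.+ + i ≡ ℤ.- + x
    -[i+x]+i i x = solve 2 (λ i x → :- (i :+ x) :+ i := :- x) refl (+ i) (+ x)
      where open ℤ-Solver

  -- Inside a stripe of even level, half of the rows of the window and an eighth of their columns carry u.
  module Dense (e b : ℕ) (lo : 1024 ℕ.^ (e ℕ.+ e) ℕ.≤ b) (hi : 8 ℕ.* b ℕ.≤ 1024 ℕ.^ suc (e ℕ.+ e)) where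

    n : ℕ
    n = 8 ℕ.* b

    -- Corners are in window coordinates. The summand `n` undoes the shift of the window's corner to
    -- (-n, -n), so these are the points (4b + t, 6c) of the picture.
    position : ℕ × ℕ → ℕ × ℕ
    position (t , c) = n ℕ.+ (4 ℕ.* b ℕ.+ t) , n ℕ.+ c ℕ.* 6

    positions : List (ℕ × ℕ)
    positions = map position (cartesianProduct (upTo (4 ℕ.* b)) (upTo b))

    position-injective : ∀ {p q} → position p ≡ position q → p ≡ q
    position-injective {t , c} {t′ , c′} eq = cong₂ _,_
      (ℕ.+-cancelˡ-≡ (4 ℕ.* b) t t′ (ℕ.+-cancelˡ-≡ n _ _ (cong proj₁ eq)))
      (ℕ.*-cancelʳ-≡ c c′ 6 (ℕ.+-cancelˡ-≡ n _ _ (cong proj₂ eq)))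

    module _ {t c : ℕ} (t< : t ℕ.< 4 ℕ.* b) (c< : c ℕ.< b) where

      private
        i j : ℕ
        i = n ℕ.+ (4 ℕ.* b ℕ.+ t)
        j = n ℕ.+ c ℕ.* 6

      4b+t<n : 4 ℕ.* b ℕ.+ t ℕ.< n
      4b+t<n = ℕ.<-≤-trans (ℕ.+-monoʳ-< (4 ℕ.* b) t<) (ℕ.≤-reflexive (sym (ℕ.*-distribʳ-+ b 4 4)))

      2n : n ℕ.+ n ≡ 2 ℕ.* n
      2n = cong (n ℕ.+_) (sym (ℕ.+-identityʳ n))

      i-fits : i ℕ.+ 1 ℕ.≤ suc (2 ℕ.* n)
      i-fits = subst₂ ℕ._≤_ (ℕ.+-comm 1 i) (cong suc 2n) (ℕ.s≤s (ℕ.+-monoʳ-≤ n (ℕ.<⇒≤ 4b+t<n)))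

      j-fits : j ℕ.+ 7 ℕ.≤ suc (2 ℕ.* n)
      j-fits = begin
        n ℕ.+ c ℕ.* 6 ℕ.+ 7
          ≡⟨ solve 2 (λ n c → n :+ c :* con 6 :+ con 7 := con 1 :+ (n :+ (con 1 :+ c) :* con 6)) refl n c ⟩
        suc (n ℕ.+ suc c ℕ.* 6)
          ≤⟨ ℕ.s≤s (ℕ.+-monoʳ-≤ n
               (ℕ.≤-trans (ℕ.*-mono-≤ c< (ℕ.m≤m+n 6 2)) (ℕ.≤-reflexive (ℕ.*-comm b 8)))) ⟩
        suc (n ℕ.+ n)
          ≡⟨ cong suc 2n ⟩
        suc (2 ℕ.* n) ∎
        where
        open ℕ.≤-Reasoning
        open ℕ-Solver

      even-row : type (+ (4 ℕ.* b ℕ.+ t)) ≡ Fin.zero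
      even-row = type-even e {+ (4 ℕ.* b ℕ.+ t)}
        (ℕ.≤-trans lo (ℕ.≤-trans (ℕ.m≤n*m b 4) (ℕ.m≤m+n (4 ℕ.* b) t)))
        (ℕ.<-≤-trans 4b+t<n hi)

      u-occurs : OccursInBlockAt (u {0}) (centred w n) (position (t , c))
      u-occurs = i-fits , j-fits , occ
        where
        occ : ∀ x y → centred w n [ inside {i = i} i-fits x , inside {i = j} j-fits y ] ≡ u {0} [ x , y ]
        occ Fin.zero y = begin
          centred w n [ inside {i = i} i-fits Fin.zero , inside {i = j} j-fits y ]
            ≡⟨ restrict-inside w {ℤ.- + n} {ℤ.- + n} {i = i} {j} i-fits j-fits Fin.zero y ⟩
          w (ℤ.- + n ℤ.+ + (i ℕ.+ 0) , ℤ.- + n ℤ.+ + (j ℕ.+ toℕ y))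
            ≡⟨ cong₂ (λ a b → w (a , b))
                 (trans (cong (λ s → ℤ.- + n ℤ.+ + s) (ℕ.+-identityʳ i)) (-n+[n+x] n (4 ℕ.* b ℕ.+ t)))
                 (trans (cong (λ s → ℤ.- + n ℤ.+ + s) (ℕ.+-assoc n (c ℕ.* 6) (toℕ y)))
                   (-n+[n+x] n (c ℕ.* 6 ℕ.+ toℕ y))) ⟩
          w (+ (4 ℕ.* b ℕ.+ t) , + (c ℕ.* 6 ℕ.+ toℕ y))
            ≡⟨ cong (λ b′ → w (+ (4 ℕ.* b ℕ.+ t) , b′))
                 (trans (ℤ.+-comm (+ (c ℕ.* 6)) (+ toℕ y)) (cong (λ x → + toℕ y ℤ.+ x) (ℤ.pos-* c 6))) ⟩
          w (+ (4 ℕ.* b ℕ.+ t) , + toℕ y ℤ.+ + c ℤ.* + 6)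
            ≡⟨ periodic {+ (4 ℕ.* b ℕ.+ t)} even-row (+ c) (toℕ y) ⟩
          letter (toℕ y ℕ.% 6) 0
            ≡⟨ periodic {+ 0} refl (+ 0) (toℕ y) ⟨
          w (+ 0 , + toℕ y ℤ.+ + 0 ℤ.* + 6)
            ≡⟨ cong (λ b → w (+ 0 , b)) (ℤ.+-comm (+ toℕ y) (+ 0)) ⟩
          w (+ 0 , + 0 ℤ.+ + toℕ y)
            ≡⟨ restrict-occurs w (+ 0 , + 0) {1} {7} Fin.zero y ⟩
          u {0} [ Fin.zero , y ] ∎
          where open ≡-Reasoning

    positions≤count : 4 ℕ.* b ℕ.* b ℕ.≤ count n
    positions≤count = subst (ℕ._≤ count n) length-positions
      (count-≥ {u = u {0}} {centred w n} positions
        (Unique.map⁺ position-injective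
          (Unique.cartesianProduct⁺ (Unique.upTo⁺ (4 ℕ.* b)) (Unique.upTo⁺ b))) occ)
      where
      length-positions : length positions ≡ 4 ℕ.* b ℕ.* b
      length-positions = trans (length-map position (cartesianProduct (upTo (4 ℕ.* b)) (upTo b)))
        (trans (length-cartesianProductWith _,_ (upTo (4 ℕ.* b)) (upTo b))
          (cong₂ ℕ._*_ (length-upTo (4 ℕ.* b)) (length-upTo b)))
      occ : ∀ {ij} → ij ∈ positions → OccursInBlockAt (u {0}) (centred w n) ij
      occ ij∈ with ∈-map⁻ position ij∈
      ... | (t , c) , tc∈ , refl = let t∈ , c∈ = ∈-cartesianProduct⁻ (upTo (4 ℕ.* b)) (upTo b) tc∈ in
        u-occurs (∈-upTo⁻ t∈) (∈-upTo⁻ c∈)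

    n²≤16*count : n ℕ.^ 2 ℕ.≤ 16 ℕ.* count n
    n²≤16*count = subst (ℕ._≤ 16 ℕ.* count n)
      (solve 1 (λ b → con 16 :* (con 4 :* b :* b) := con 8 :* b :* (con 8 :* b :* con 1)) refl b)
      (ℕ.*-monoʳ-≤ 16 positions≤count)
      where open ℕ-Solver

  -- All occurrences of u in the window come from the rows |i| < M below the stripe of odd level.
  module Sparse (e n : ℕ) (lo : 512 ℕ.* 1024 ℕ.^ suc (e ℕ.+ e) ℕ.≤ n)
    (hi : n ℕ.< 1024 ℕ.^ suc (suc (e ℕ.+ e))) where

    M : ℕ
    M = 1024 ℕ.^ suc (e ℕ.+ e)

    M≤n : M ℕ.≤ n
    M≤n = ℕ.≤-trans (ℕ.m≤n*m M 512) lo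

    positions : List (ℕ × ℕ)
    positions = cartesianProduct (map (n ℕ.∸ M ℕ.+_) (upTo (2 ℕ.* M))) (upTo (2 ℕ.+ 2 ℕ.* n))

    -- A window row outside this range, on either side, has absolute value at least M and at most n,
    -- hence odd level.
    near : ∀ i → i ℕ.≤ 2 ℕ.* n → type (ℤ.- + n ℤ.+ + i) ≡ Fin.zero →
      n ℕ.∸ M ℕ.≤ i × i ℕ.< n ℕ.∸ M ℕ.+ 2 ℕ.* M
    near i i≤2n even = ℕ.m≤n+o⇒m∸n≤o n M (ℕ.≮⇒≥ ≮) , <
      where
      ≮ : ¬ M ℕ.+ i ℕ.< n
      ≮ M+i<n = type-odd e {ℤ.- + n ℤ.+ + i}
        (subst (M ℕ.≤_) (sym abs) (ℕ.m+n≤o⇒m≤o∸n M (ℕ.<⇒≤ M+i<n)))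
        (subst (ℕ._< 1024 ℕ.^ suc (suc (e ℕ.+ e))) (sym abs) (ℕ.≤-<-trans (ℕ.m∸n≤m n i) hi)) even
        where
        abs : ℤ.∣ ℤ.- + n ℤ.+ + i ∣ ≡ n ℕ.∸ i
        abs = trans (cong (λ s → ℤ.∣ ℤ.- + s ℤ.+ + i ∣) (sym (ℕ.m+[n∸m]≡n (ℕ.m+n≤o⇒n≤o M (ℕ.<⇒≤ M+i<n)))))
          (trans (cong ℤ.∣_∣ (-[i+x]+i i (n ℕ.∸ i))) (ℤ.∣-i∣≡∣i∣ (+ (n ℕ.∸ i))))
      ≱ : ¬ n ℕ.+ M ℕ.≤ i
      ≱ n+M≤i = type-odd e {ℤ.- + n ℤ.+ + i}
        (subst (M ℕ.≤_) (sym abs) (ℕ.m+n≤o⇒m≤o∸n M (subst (ℕ._≤ i) (ℕ.+-comm n M) n+M≤i)))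
        (subst (ℕ._< 1024 ℕ.^ suc (suc (e ℕ.+ e))) (sym abs)
          (ℕ.≤-<-trans (ℕ.m≤n+o⇒m∸n≤o i n (subst (i ℕ.≤_) (cong (n ℕ.+_) (ℕ.+-identityʳ n)) i≤2n)) hi)) even
        where
        abs : ℤ.∣ ℤ.- + n ℤ.+ + i ∣ ≡ i ℕ.∸ n
        abs = trans (cong (λ s → ℤ.∣ ℤ.- + n ℤ.+ + s ∣) (sym (ℕ.m+[n∸m]≡n (ℕ.m+n≤o⇒m≤o n n+M≤i))))
          (cong ℤ.∣_∣ (-n+[n+x] n (i ℕ.∸ n)))
      < : i ℕ.< n ℕ.∸ M ℕ.+ 2 ℕ.* M
      < = subst (i ℕ.<_) (trans (cong (ℕ._+ M) (sym (ℕ.m∸n+n≡m M≤n)))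
        (trans (ℕ.+-assoc (n ℕ.∸ M) M M) (cong (λ x → n ℕ.∸ M ℕ.+ (M ℕ.+ x)) (sym (ℕ.+-identityʳ M)))))
          (ℕ.≰⇒> ≱)

    count≤positions : count n ℕ.≤ 2 ℕ.* M ℕ.* (2 ℕ.+ 2 ℕ.* n)
    count≤positions = subst (count n ℕ.≤_) length-positions
      (count-≤ {u = u {0}} {centred w n} positions occ)
      where
      length-positions : length positions ≡ 2 ℕ.* M ℕ.* (2 ℕ.+ 2 ℕ.* n)
      length-positions = trans
        (length-cartesianProductWith _,_ (map (n ℕ.∸ M ℕ.+_) (upTo (2 ℕ.* M))) (upTo (2 ℕ.+ 2 ℕ.* n)))
        (cong₂ ℕ._*_ (trans (length-map (n ℕ.∸ M ℕ.+_) (upTo (2 ℕ.* M))) (length-upTo (2 ℕ.* M)))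
          (length-upTo (2 ℕ.+ 2 ℕ.* n)))
      occ : ∀ ij → OccursInBlockAt (u {0}) (centred w n) ij → ij ∈ positions
      occ (i , j) o@(p , q , _) = ∈-cartesianProduct⁺ {xs = map (n ℕ.∸ M ℕ.+_) (upTo (2 ℕ.* M))}
        (subst (_∈ map (n ℕ.∸ M ℕ.+_) (upTo (2 ℕ.* M))) (ℕ.m+[n∸m]≡n i≥)
          (∈-map⁺ (n ℕ.∸ M ℕ.+_)
            (∈-upTo⁺ (ℕ.+-cancelˡ-< (n ℕ.∸ M) (i ℕ.∸ (n ℕ.∸ M)) (2 ℕ.* M)
              (subst (ℕ._< n ℕ.∸ M ℕ.+ 2 ℕ.* M) (sym (ℕ.m+[n∸m]≡n i≥)) i<)))))
        (∈-upTo⁺ (ℕ.s≤s (ℕ.m+n≤o⇒m≤o j q)))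
        where
        i≤2n : i ℕ.≤ 2 ℕ.* n
        i≤2n = ℕ.≤-pred (subst (ℕ._≤ suc (2 ℕ.* n)) (ℕ.+-comm i 1) p)
        bounds = near i i≤2n (occurs⇒periodic {0} {c = ℤ.- + n} {ℤ.- + n} {i} {j} o)
        i≥ = proj₁ bounds
        i< = proj₂ bounds

    -- There are 2M rows and at most 4n columns to choose from, so at most 8Mn occurrences;
    -- `n ≥ 512 M` turns this into n²/64.
    64*count≤n² : 64 ℕ.* count n ℕ.≤ n ℕ.^ 2
    64*count≤n² = begin
      64 ℕ.* count n
        ≤⟨ ℕ.*-monoʳ-≤ 64 count≤positions ⟩
      64 ℕ.* (2 ℕ.* M ℕ.* (2 ℕ.+ 2 ℕ.* n))
        ≤⟨ ℕ.*-monoʳ-≤ 64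
             (ℕ.*-monoʳ-≤ (2 ℕ.* M)
               (ℕ.+-monoˡ-≤ (2 ℕ.* n) (ℕ.*-monoʳ-≤ 2 (ℕ.≤-trans (1≤1024^e (suc (e ℕ.+ e))) M≤n)))) ⟩
      64 ℕ.* (2 ℕ.* M ℕ.* (2 ℕ.* n ℕ.+ 2 ℕ.* n))
        ≡⟨ solve 2 (λ m n → con 64 :* (con 2 :* m :* (con 2 :* n :+ con 2 :* n)) := con 512 :* m :* n)
             refl M n ⟩
      512 ℕ.* M ℕ.* n
        ≤⟨ ℕ.*-monoˡ-≤ n lo ⟩
      n ℕ.* n
        ≡⟨ cong (n ℕ.*_) (ℕ.*-identityʳ n) ⟨
      n ℕ.^ 2 ∎
      where
      open ℕ.≤-Reasoning
      open ℕ-Solver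

  private
    ≤-from-ℕ : ∀ {a c x f} → suc c ℕ.* f ℕ.≥ a ℕ.* x → mkℚᵘ (+ a) c ℚ.* fromℕ x ℚ.≤ fromℕ f
    ≤-from-ℕ {a} {c} {x} {f} le = *≤* (subst₂ ℤ._≤_
      (trans (ℤ.pos-* a x) (sym (ℤ.*-identityʳ _)))
      (trans (cong +_ (trans (ℕ.*-comm (suc c) f) (cong (f ℕ.*_) (sym (ℕ.*-identityʳ (suc c))))))
        (ℤ.pos-* f _))
      (ℤ.+≤+ le))

    ≥-from-ℕ : ∀ {a c x f} → suc c ℕ.* f ℕ.≤ a ℕ.* x → fromℕ f ℚ.≤ mkℚᵘ (+ a) c ℚ.* fromℕ x
    ≥-from-ℕ {a} {c} {x} {f} le = *≤* (subst₂ ℤ._≤_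
      (trans (cong +_ (trans (ℕ.*-comm (suc c) f) (cong (f ℕ.*_) (sym (ℕ.*-identityʳ (suc c))))))
        (ℤ.pos-* f _))
      (trans (ℤ.pos-* a x) (sym (ℤ.*-identityʳ _)))
      (ℤ.+≤+ le))

  ¬hasFrequencies : ¬ HasFrequencies w
  -- Dense windows give quotients of at least 1/16 = 4/64, sparse ones of at most 1/64, so 3/64 with
  -- tolerance 1/64 separates them.
  ¬hasFrequencies frequencies = oscillating⇒¬Convergent count {+ 3 ℚ./ 64} {+ 1 ℚ./ 64}
    (*<* (ℤ.+<+ (ℕ.s≤s ℕ.z≤n))) high low
    (frequencies (u {0}) (restrict-isBlock w (+ 0 , + 0)))
    where
    high : ∀ N → ∃[ n ] N ℕ.≤ n × (+ 3 ℚ./ 64 ℚ.+ + 1 ℚ./ 64) ℚ.* fromℕ (n ℕ.^ 2) ℚ.≤ fromℕ (count n)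
    high N = n , ℕ.≤-trans (e≤1024^[e+e] N) (ℕ.≤-trans M≤b (ℕ.m≤n*m b 8)) ,
      -- Unnormalised addition multiplies the denominators: 3/64 + 1/64 is 256/4096, and `mkℚᵘ`
      -- stores the denominator minus one.
      ≤-from-ℕ {256} {4095} {n ℕ.^ 2} {count n}
        (ℕ.≤-trans (ℕ.*-monoʳ-≤ 256 n²≤16*count) (ℕ.≤-reflexive (sym (ℕ.*-assoc 256 16 (count n)))))
      where
      b : ℕ
      b = 64 ℕ.* 1024 ℕ.^ (N ℕ.+ N)
      M≤b : 1024 ℕ.^ (N ℕ.+ N) ℕ.≤ b
      M≤b = ℕ.m≤n*m (1024 ℕ.^ (N ℕ.+ N)) 64
      8b≤ : 8 ℕ.* b ℕ.≤ 1024 ℕ.^ suc (N ℕ.+ N)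
      8b≤ = ℕ.≤-trans (ℕ.≤-reflexive (sym (ℕ.*-assoc 8 64 (1024 ℕ.^ (N ℕ.+ N)))))
        (ℕ.*-monoˡ-≤ (1024 ℕ.^ (N ℕ.+ N)) (ℕ.≤ᵇ⇒≤ 512 1024 _))
      open Dense N b M≤b 8b≤
    low : ∀ N → ∃[ n ] N ℕ.≤ n × fromℕ (count n) ℚ.≤ (+ 3 ℚ./ 64 ℚ.- + 1 ℚ./ 64) ℚ.* fromℕ (n ℕ.^ 2)
    low N = n , ℕ.≤-trans (e≤1024^[e+e] N) (ℕ.≤-trans (ℕ.m≤n*m (1024 ℕ.^ (N ℕ.+ N)) 1024) M≤n) ,
      ≥-from-ℕ {128} {4095} {n ℕ.^ 2} {count n}
        (ℕ.≤-trans (ℕ.≤-reflexive (ℕ.*-assoc 64 64 (count n)))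
          (ℕ.≤-trans (ℕ.*-monoʳ-≤ 64 64*count≤n²) (ℕ.*-monoˡ-≤ (n ℕ.^ 2) (ℕ.m≤m+n 64 64))))
      where
      n : ℕ
      n = 512 ℕ.* 1024 ℕ.^ suc (N ℕ.+ N)
      n< : n ℕ.< 1024 ℕ.^ suc (suc (N ℕ.+ N))
      n< = ℕ.*-monoˡ-< (1024 ℕ.^ suc (N ℕ.+ N)) {{ℕ.m^n≢0 1024 (suc (N ℕ.+ N))}} (ℕ.≤ᵇ⇒≤ 513 1024 _)
      open Sparse N n ℕ.≤-refl n<

-- Markers containing every finite pattern

module _ {A : Set} where

  -- Totalised lookup, which lets a finite table stand for a function on all of ℕ.
  at : A → ∀ {n} → Vec A n → ℕ → A
  at d []       i       = d
  at d (x ∷ xs) zero    = x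
  at d (x ∷ xs) (suc i) = at d xs i

  at-lookup : ∀ d {n} (xs : Vec A n) i → at d xs (toℕ i) ≡ lookup xs i
  at-lookup d (x ∷ xs) Fin.zero    = refl
  at-lookup d (x ∷ xs) (Fin.suc i) = at-lookup d xs i

  at-tabulate : ∀ d (f : ℕ → A) {n i} → i ℕ.< n → at d (tabulate {n = n} (f ∘ toℕ)) i ≡ f i
  at-tabulate d f {n} {i} i<n = begin
    at d fs i                        ≡⟨ cong (at d fs) (Fin.toℕ-fromℕ< i<n) ⟨
    at d fs (toℕ (fromℕ< i<n))       ≡⟨ at-lookup d fs (fromℕ< i<n) ⟩
    lookup fs (fromℕ< i<n)           ≡⟨ Vec.lookup∘tabulate (f ∘ toℕ) (fromℕ< i<n) ⟩
    f (toℕ (fromℕ< i<n))             ≡⟨ cong f (Fin.toℕ-fromℕ< i<n) ⟩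
    f i                              ∎
    where
    open ≡-Reasoning
    fs : Vec A n
    fs = tabulate (f ∘ toℕ)

module _ (D : ℕ) .{{_ : NonZero D}} where

  digit : ℕ → ℕ → Fin D
  digit zero    e = e ℕ.mod D
  digit (suc i) e = digit i (e ℕ./ D)

  [r+q*D]mod : ∀ (r : Fin D) q → (toℕ r ℕ.+ q ℕ.* D) ℕ.mod D ≡ r
  [r+q*D]mod r q = Fin.toℕ-injective (trans (Fin.toℕ-fromℕ< _)
    (trans (ℕ.[m+kn]%n≡m%n (toℕ r) q D) (ℕ.m<n⇒m%n≡m (Fin.toℕ<n r))))

  [r+q*d]/d : ∀ {r} q → r ℕ.< D → (r ℕ.+ q ℕ.* D) ℕ./ D ≡ q
  [r+q*d]/d {r} q r<D = trans (ℕ.+-distrib-/-∣ʳ r (divides q refl))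
    (cong₂ ℕ._+_ (ℕ.m<n⇒m/n≡0 r<D) (ℕ.m*n/n≡m q D))

  [r+q*d]%d : ∀ {r} q → r ℕ.< D → (r ℕ.+ q ℕ.* D) ℕ.% D ≡ r
  [r+q*d]%d {r} q r<D = trans (ℕ.[m+kn]%n≡m%n r q D) (ℕ.m<n⇒m%n≡m r<D)

  -- Horner's scheme started from `b` instead of 0: `b` sits above the `n` prescribed digits and
  -- forces `b ≤ e`.
  digits : ∀ (f : ℕ → Fin D) n b → ∃[ e ] b ℕ.≤ e × (∀ {i} → i ℕ.< n → digit i e ≡ f i)
  digits f zero    b = b , ℕ.≤-refl , λ ()
  digits f (suc n) b with digits (f ∘ suc) n b
  ... | e , b≤e , digit-e = toℕ (f 0) ℕ.+ e ℕ.* D ,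
    ℕ.≤-trans b≤e (ℕ.≤-trans (ℕ.m≤m*n e D) (ℕ.m≤n+m (e ℕ.* D) (toℕ (f 0)))) ,
    λ { {zero}  _           → [r+q*D]mod (f 0) e
      ; {suc i} (ℕ.s≤s i<n) → trans (cong (digit i) ([r+q*d]/d e (Fin.toℕ<n (f 0)))) (digit-e i<n) }

  open Level (λ e → e ℕ.* e) (λ a<b → ℕ.*-mono-< a<b a<b)

  private
    level-square : ∀ e {y} → y ℕ.≤ e → level (e ℕ.* e ℕ.+ y) ≡ e
    level-square e {y} y≤e = level-unique {e} (ℕ.m≤m+n (e ℕ.* e) y)
      (subst (suc (e ℕ.* e ℕ.+ y) ℕ.≤_)
        (solve 1 (λ e → con 1 :+ (e :* e :+ (e :+ e)) := (con 1 :+ e) :* (con 1 :+ e)) refl e)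
        (ℕ.s≤s (ℕ.+-monoʳ-≤ (e ℕ.* e) (ℕ.≤-trans y≤e (ℕ.m≤m+n e e)))))
      where open ℕ-Solver

    rest : ℕ → ℕ
    rest n = n ℕ.∸ level n ℕ.* level n

    rest-square : ∀ e {y} → y ℕ.≤ e → rest (e ℕ.* e ℕ.+ y) ≡ y
    rest-square e {y} y≤e = trans (cong (λ l → e ℕ.* e ℕ.+ y ℕ.∸ l ℕ.* l) (level-square e y≤e))
      (ℕ.m+n∸m≡n (e ℕ.* e) y)

    -- Decoded like the column numbers: as y ≤ x + y, `level` returns x + y and `rest` returns y.
    pair : ℕ → ℕ → ℕ
    pair x y = (x ℕ.+ y) ℕ.* (x ℕ.+ y) ℕ.+ y

  -- Column e² + y, with y ≤ e, lists in its rows x the digits of e with number pair x y.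
  universal : ℤ × ℤ → Fin D
  universal (i , j) = digit (pair ℤ.∣ i ∣ (rest ℤ.∣ j ∣)) (level ℤ.∣ j ∣)

  -- Written along the pairing, the pattern becomes a digit sequence of some `e`; the pairs with
  -- both entries below `b` have numbers below (b + b)² + b. The further demand `b ≤ e` makes the
  -- run of columns that list the digits of `e` wide enough for the pattern.
  universal-contains : ∀ (F : ℕ → ℕ → Fin D) b →
    ∃[ c ] (∀ {x y} → x ℕ.< b → y ℕ.< b → universal (+ x , + (c ℕ.+ y)) ≡ F x y)
  universal-contains F b with digits (λ n → F (level n ℕ.∸ rest n) (rest n))
    ((b ℕ.+ b) ℕ.* (b ℕ.+ b) ℕ.+ b) b
  ... | e , b≤e , digit-e = e ℕ.* e , contains
    where
    contains : ∀ {x y} → x ℕ.< b → y ℕ.< b → universal (+ x , + (e ℕ.* e ℕ.+ y)) ≡ F x y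
    contains {x} {y} x<b y<b = begin
      digit (pair x (rest (e ℕ.* e ℕ.+ y))) (level (e ℕ.* e ℕ.+ y))
        ≡⟨ cong₂ (λ y e → digit (pair x y) e) (rest-square e y≤e) (level-square e y≤e) ⟩
      digit (pair x y) e
        ≡⟨ digit-e (ℕ.+-mono-≤-< (ℕ.*-mono-≤ x+y≤ x+y≤) y<b) ⟩
      F (level (pair x y) ℕ.∸ rest (pair x y)) (rest (pair x y))
        ≡⟨ cong₂ (λ s y → F (s ℕ.∸ y) y) (level-square (x ℕ.+ y) (ℕ.m≤n+m y x))
             (rest-square (x ℕ.+ y) (ℕ.m≤n+m y x)) ⟩
      F (x ℕ.+ y ℕ.∸ y) y
        ≡⟨ cong (λ x → F x y) (ℕ.m+n∸n≡m x y) ⟩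
      F x y ∎
      where
      open ≡-Reasoning
      y≤e : y ℕ.≤ e
      y≤e = ℕ.≤-trans (ℕ.<⇒≤ y<b) b≤e
      x+y≤ : x ℕ.+ y ℕ.≤ b ℕ.+ b
      x+y≤ = ℕ.+-mono-≤ (ℕ.<⇒≤ x<b) (ℕ.<⇒≤ y<b)

module Universal (k D : ℕ) .{{_ : NonZero D}} where

  open Marker k D (universal D) public

  module _ (n : ℕ) where

    M : ℕ
    M = n ℕ./ P

    -- A normal form for the blocks of `w`: `r` is the offset of the left edge inside its tile, and
    -- `F x z` is the marker offset in row `x` of the z-th tile met.
    block : ℕ → (ℕ → ℕ → Fin D) → Block (2 ℕ.+ k) n n
    block r F = tabulate λ x → tabulate λ y → letter ((r ℕ.+ toℕ y) ℕ.% P)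
      (toℕ (F (toℕ x) ((r ℕ.+ toℕ y) ℕ./ P)))

    block-at : ∀ r F x y → block r F [ x , y ] ≡ letter ((r ℕ.+ toℕ y) ℕ.% P)
      (toℕ (F (toℕ x) ((r ℕ.+ toℕ y) ℕ./ P)))
    block-at r F = block-lookup _

    block-isBlock : ∀ r F → block r F IsBlockOf w
    -- One bound for both coordinates: rows are below `n`, and tile numbers are at most r + y, hence
    -- below r + n.
    block-isBlock r F with universal-contains D F (n ℕ.+ (r ℕ.+ n))
    ... | c , contains = (+ 0 , + r ℤ.+ + c ℤ.* + P) , λ x y → begin
      w (+ toℕ x , + r ℤ.+ + c ℤ.* + P ℤ.+ + toℕ y)
        ≡⟨ cong (λ j → w (+ toℕ x , j)) (shift (+ r) (+ c ℤ.* + P) (+ toℕ y)) ⟩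
      w (+ toℕ x , + (r ℕ.+ toℕ y) ℤ.+ + c ℤ.* + P)
        ≡⟨ w-at (+ toℕ x) (+ c) (r ℕ.+ toℕ y) ⟩
      letter ((r ℕ.+ toℕ y) ℕ.% P) (toℕ (universal D (+ toℕ x , + (c ℕ.+ (r ℕ.+ toℕ y) ℕ./ P))))
        ≡⟨ cong (λ a → letter ((r ℕ.+ toℕ y) ℕ.% P) (toℕ a)) (contains
             (ℕ.<-≤-trans (Fin.toℕ<n x) (ℕ.m≤m+n n (r ℕ.+ n)))
             (ℕ.≤-<-trans (ℕ.m/n≤m (r ℕ.+ toℕ y) P)
               (ℕ.<-≤-trans (ℕ.+-monoʳ-< r (Fin.toℕ<n y)) (ℕ.m≤n+m (r ℕ.+ n) n)))) ⟩
      letter ((r ℕ.+ toℕ y) ℕ.% P) (toℕ (F (toℕ x) ((r ℕ.+ toℕ y) ℕ./ P)))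
        ≡⟨ block-at r F x y ⟨
      block r F [ x , y ] ∎
      where
      open ≡-Reasoning
      shift : ∀ a b c → a ℤ.+ b ℤ.+ c ≡ a ℤ.+ c ℤ.+ b
      shift = solve 3 (λ a b c → a :+ b :+ c := a :+ c :+ b) refl
        where open ℤ-Solver

    isBlock⇒block : ∀ {u} → u IsBlockOf w → ∃[ r ] r ℕ.< P × ∃[ F ] u ≡ block r F
    isBlock⇒block {u} ((i , j) , occ) = r , ℤ.n%ℕd<d j P , F , block-ext λ x y → begin
      u [ x , y ]
        ≡⟨ occ x y ⟨
      w (i ℤ.+ + toℕ x , j ℤ.+ + toℕ y)
        ≡⟨ cong (λ j → w (i ℤ.+ + toℕ x , j))
             (trans (cong (ℤ._+ + toℕ y) (ℤ.a≡a%ℕn+[a/ℕn]*n j P)) (shift (+ r) (m ℤ.* + P) (+ toℕ y))) ⟩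
      w (i ℤ.+ + toℕ x , + (r ℕ.+ toℕ y) ℤ.+ m ℤ.* + P)
        ≡⟨ w-at (i ℤ.+ + toℕ x) m (r ℕ.+ toℕ y) ⟩
      letter ((r ℕ.+ toℕ y) ℕ.% P) (toℕ (F (toℕ x) ((r ℕ.+ toℕ y) ℕ./ P)))
        ≡⟨ block-at r F x y ⟨
      block r F [ x , y ] ∎
      where
      open ≡-Reasoning
      r = j ℤ.%ℕ P
      m = j ℤ./ℕ P
      F : ℕ → ℕ → Fin D
      F x z = universal D (i ℤ.+ + x , m ℤ.+ + z)
      shift : ∀ a b c → a ℤ.+ b ℤ.+ c ≡ a ℤ.+ c ℤ.+ b
      shift = solve 3 (λ a b c → a :+ b :+ c := a :+ c :+ b) refl
        where open ℤ-Solver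

    private
      blank : Fin D
      blank = 0 ℕ.mod D

    entries : ∀ {N} → Block D n N → ℕ → ℕ → Fin D
    entries {N} T x = at blank (at (Vec.replicate N blank) T x)

    entries-lookup : ∀ {N} (T : Block D n N) x z → entries T (toℕ x) (toℕ z) ≡ T [ x , z ]
    entries-lookup {N} T x z = trans
      (cong (λ row → at blank row (toℕ z)) (at-lookup (Vec.replicate N blank) T x))
      (at-lookup blank (lookup T x) z)

    truncate : ∀ N → (ℕ → ℕ → Fin D) → Block D n N
    truncate N F = tabulate λ x → tabulate λ z → F (toℕ x) (toℕ z)

    entries-truncate : ∀ {N} F {x z} → x ℕ.< n → z ℕ.< N → entries (truncate N F) x z ≡ F x z
    entries-truncate {N} F {x} {z} x<n z<N = trans
      (cong (λ row → at blank row z)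
        (at-tabulate (Vec.replicate N blank) (λ x → tabulate λ z → F x (toℕ z)) x<n))
      (at-tabulate blank (F x) z<N)

    -- A block reads no tile beyond (P + n) / P = 1 + M, so tables with 2 + M columns suffice. This
    -- makes the list of candidates finite.
    block-truncate : ∀ {r} F → r ℕ.< P → block r (entries (truncate (2 ℕ.+ M) F)) ≡ block r F
    block-truncate {r} F r<P = block-ext λ x y → begin
      block r (entries (truncate (2 ℕ.+ M) F)) [ x , y ]
        ≡⟨ block-at r (entries (truncate (2 ℕ.+ M) F)) x y ⟩
      letter ((r ℕ.+ toℕ y) ℕ.% P) (toℕ (entries (truncate (2 ℕ.+ M) F) (toℕ x) ((r ℕ.+ toℕ y) ℕ./ P)))
        ≡⟨ cong (λ a → letter ((r ℕ.+ toℕ y) ℕ.% P) (toℕ a)) (entries-truncate F (Fin.toℕ<n x) (tile< y)) ⟩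
      letter ((r ℕ.+ toℕ y) ℕ.% P) (toℕ (F (toℕ x) ((r ℕ.+ toℕ y) ℕ./ P)))
        ≡⟨ block-at r F x y ⟨
      block r F [ x , y ] ∎
      where
      open ≡-Reasoning
      tile< : ∀ y → (r ℕ.+ toℕ {n} y) ℕ./ P ℕ.< 2 ℕ.+ M
      tile< y = ℕ.s≤s (ℕ.≤-trans (ℕ./-monoˡ-≤ P (ℕ.+-mono-≤ (ℕ.<⇒≤ r<P) (ℕ.<⇒≤ (Fin.toℕ<n y))))
        (ℕ.≤-reflexive
          (trans (ℕ.+-distrib-/-∣ˡ n (divides 1 (sym (ℕ.*-identityˡ P)))) (cong (ℕ._+ M) (ℕ.n/n≡1 P)))))

    tables : ∀ N → List (Block D n N)
    tables N = allVecs (allVecs (allFin D) N) n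

    length-tables : ∀ N → length (tables N) ≡ D ℕ.^ (N ℕ.* n)
    length-tables N = begin
      length (tables N)                            ≡⟨ length-allVecs (allVecs (allFin D) N) n ⟩
      length (allVecs (allFin D) N) ℕ.^ n          ≡⟨ cong (ℕ._^ n) (length-allVecs (allFin D) N) ⟩
      (length (allFin D) ℕ.^ N) ℕ.^ n              ≡⟨ cong (λ l → (l ℕ.^ N) ℕ.^ n)
        (length-tabulate {n = D} (λ i → i)) ⟩
      (D ℕ.^ N) ℕ.^ n                              ≡⟨ ℕ.^-*-assoc D N n ⟩
      D ℕ.^ (N ℕ.* n)                              ∎
      where open ≡-Reasoning

    ∈-tables : ∀ {N} (T : Block D n N) → T ∈ tables N
    ∈-tables = ∈-allVecs (∈-allVecs ∈-allFin)

    -- Duplicates do arise: tables that differ only in markers lying outside the block give the same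
    -- block.
    candidates blocks : List (Block (2 ℕ.+ k) n n)
    candidates = cartesianProductWith (λ r T → block r (entries T)) (upTo P) (tables (2 ℕ.+ M))
    blocks     = deduplicate _≟-block_ candidates

    ∈-blocks⇔ : ∀ u → u ∈ blocks ⇔ u IsBlockOf w
    ∈-blocks⇔ u = mk⇔ to from
      where
      to : u ∈ blocks → u IsBlockOf w
      to u∈ with ∈-cartesianProductWith⁻ (λ r T → block r (entries T)) (upTo P) (tables (2 ℕ.+ M))
        (∈-deduplicate⁻ _≟-block_ candidates u∈)
      ... | r , T , _ , _ , refl = block-isBlock r (entries T)
      from : u IsBlockOf w → u ∈ blocks
      from u-isBlock with isBlock⇒block {u} u-isBlock
      ... | r , r<P , F , u≡block = ∈-deduplicate⁺ _≟-block_
        (subst (_∈ candidates) (trans (block-truncate F r<P) (sym u≡block))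
        (∈-cartesianProductWith⁺ (λ r T → block r (entries T)) (∈-upTo⁺ r<P)
          (∈-tables (truncate (2 ℕ.+ M) F))))

    blockCount : BlockCount w n (length blocks)
    blockCount = blocks , deduplicate-! _≟-block_ candidates , ∈-blocks⇔ , refl

    blocks-≤ : length blocks ℕ.≤ P ℕ.* D ℕ.^ ((2 ℕ.+ M) ℕ.* n)
    blocks-≤ = begin
      length blocks
        ≤⟨ Unique⇒length-mono (deduplicate-! _≟-block_ candidates) (∈-deduplicate⁻ _≟-block_ candidates) ⟩
      length candidates
        ≡⟨ length-cartesianProductWith (λ r T → block r (entries T)) (upTo P) (tables (2 ℕ.+ M)) ⟩
      length (upTo P) ℕ.* length (tables (2 ℕ.+ M))
        ≡⟨ cong₂ ℕ._*_ (length-upTo P) (length-tables (2 ℕ.+ M)) ⟩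
      P ℕ.* D ℕ.^ ((2 ℕ.+ M) ℕ.* n) ∎
      where open ℕ.≤-Reasoning

    -- An aligned block shows, in every tile it contains, the marker and hence the entry of the table.
    aligned-injective : ∀ {S T : Block D n M} → block 0 (entries S) ≡ block 0 (entries T) → S ≡ T
    aligned-injective {S} {T} eq = block-ext λ x m → Fin.toℕ-injective (letter⁻¹ {k} (begin
      letter (toℕ (S [ x , m ])) (toℕ (T [ x , m ]))  ≡⟨ shows T x m (S [ x , m ]) ⟨
      block 0 (entries T) [ x , cell m (S [ x , m ]) ] ≡⟨ cong (_[ x , cell m (S [ x , m ]) ]) eq ⟨
      block 0 (entries S) [ x , cell m (S [ x , m ]) ] ≡⟨ shows S x m (S [ x , m ]) ⟩
      letter (toℕ (S [ x , m ])) (toℕ (S [ x , m ]))  ≡⟨ letter-refl (toℕ (S [ x , m ])) ⟩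
      Fin.suc Fin.zero                                 ∎))
      where
      open ≡-Reasoning
      s<P : ∀ (s : Fin D) → toℕ s ℕ.< P
      s<P s = ℕ.<-≤-trans (Fin.toℕ<n s) (ℕ.m≤n*m D 3)
      cell<n : ∀ (m : Fin M) (s : Fin D) → toℕ s ℕ.+ toℕ m ℕ.* P ℕ.< n
      cell<n m s = ℕ.<-≤-trans (ℕ.+-monoˡ-< (toℕ m ℕ.* P) (s<P s))
        (ℕ.≤-trans (ℕ.*-monoˡ-≤ P (Fin.toℕ<n m)) (ℕ.m/n*n≤m n P))
      cell : Fin M → Fin D → Fin n
      cell m s = fromℕ< (cell<n m s)
      shows : ∀ (T : Block D n M) x m s → block 0 (entries T) [ x , cell m s ] ≡ letter (toℕ s)
        (toℕ (T [ x , m ]))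
      shows T x m s = begin
        block 0 (entries T) [ x , cell m s ]
          ≡⟨ block-at 0 (entries T) x (cell m s) ⟩
        letter (toℕ (cell m s) ℕ.% P) (toℕ (entries T (toℕ x) (toℕ (cell m s) ℕ./ P)))
          ≡⟨ cong (λ y → letter (y ℕ.% P) (toℕ (entries T (toℕ x) (y ℕ./ P))))
               (Fin.toℕ-fromℕ< (cell<n m s)) ⟩
        letter ((toℕ s ℕ.+ toℕ m ℕ.* P) ℕ.% P) (toℕ (entries T (toℕ x) ((toℕ s ℕ.+ toℕ m ℕ.* P) ℕ./ P)))
          ≡⟨ cong₂ (λ r q → letter r (toℕ (entries T (toℕ x) q))) ([r+q*d]%d P (toℕ m) (s<P s))
               ([r+q*d]/d P (toℕ m) (s<P s)) ⟩
        letter (toℕ s) (toℕ (entries T (toℕ x) (toℕ m)))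
          ≡⟨ cong (λ a → letter (toℕ s) (toℕ a)) (entries-lookup T x m) ⟩
        letter (toℕ s) (toℕ (T [ x , m ])) ∎

    -- Only blocks starting at a tile boundary are counted. They contain M whole tiles per row,
    -- whose markers are chosen freely; a cut-off last tile takes the default offset.
    blocks-≥ : D ℕ.^ (M ℕ.* n) ℕ.≤ length blocks
    blocks-≥ = begin
      D ℕ.^ (M ℕ.* n)                           ≡⟨ length-tables M ⟨
      length (tables M)                         ≡⟨ length-map (block 0 ∘ entries) (tables M) ⟨
      length (map (block 0 ∘ entries) (tables M)) ≤⟨ Unique⇒length-mono
        (Unique.map⁺ aligned-injective (allVecs-! (allVecs-! (Unique.allFin⁺ D) M) n)) ⊆blocks ⟩
      length blocks                             ∎
      where
      open ℕ.≤-Reasoning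
      ⊆blocks : ∀ {u} → u ∈ map (block 0 ∘ entries) (tables M) → u ∈ blocks
      ⊆blocks u∈ with ∈-map⁻ (block 0 ∘ entries) u∈
      ... | T , _ , refl = Equivalence.from (∈-blocks⇔ _) (block-isBlock 0 (entries T))

-- Entropy bounds and the six examples

-- Absorbs the number P = 3m of left-edge offsets into a power of the alphabet size, using 3 ≤ 4 ≤
-- m².
3*m*m^e≤m^[3+e] : ∀ m e → 2 ℕ.≤ m → 3 ℕ.* m ℕ.* m ℕ.^ e ℕ.≤ m ℕ.^ (3 ℕ.+ e)
3*m*m^e≤m^[3+e] m e 2≤m = begin
  3 ℕ.* m ℕ.* m ℕ.^ e         ≤⟨ ℕ.*-monoˡ-≤ (m ℕ.^ e)
    (ℕ.*-monoˡ-≤ m (ℕ.≤-trans (ℕ.n≤1+n 3) (ℕ.*-mono-≤ 2≤m 2≤m))) ⟩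
  m ℕ.* m ℕ.* m ℕ.* m ℕ.^ e   ≡⟨ solve 2 (λ d x → d :* d :* d :* x := d :* (d :* (d :* x))) refl m
    (m ℕ.^ e) ⟩
  m ℕ.^ (3 ℕ.+ e)             ∎
  where
  open ℕ.≤-Reasoning
  open ℕ-Solver

n²≤P*lo : ∀ P n .{{_ : NonZero P}} → 1 ℕ.* n ℕ.^ 2 ℕ.≤ P ℕ.* (n ℕ./ P ℕ.* n ℕ.+ 5 ℕ.* n)
n²≤P*lo P n = begin
  1 ℕ.* n ℕ.^ 2
    ≡⟨ solve 1 (λ n → con 1 :* (n :* (n :* con 1)) := n :* n) refl n ⟩
  n ℕ.* n
    ≡⟨ cong (ℕ._* n) (ℕ.m≡m%n+[m/n]*n n P) ⟩
  (n ℕ.% P ℕ.+ n ℕ./ P ℕ.* P) ℕ.* n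
    ≤⟨ ℕ.*-monoˡ-≤ n (ℕ.+-monoˡ-≤ (n ℕ./ P ℕ.* P) (ℕ.≤-trans (ℕ.m%n≤n n P) (ℕ.m≤n*m P 5))) ⟩
  (5 ℕ.* P ℕ.+ n ℕ./ P ℕ.* P) ℕ.* n
    ≡⟨ solve 3 (λ p m n → (con 5 :* p :+ m :* p) :* n := p :* (m :* n :+ con 5 :* n)) refl P (n ℕ./ P) n ⟩
  P ℕ.* (n ℕ./ P ℕ.* n ℕ.+ 5 ℕ.* n) ∎
  where
  open ℕ.≤-Reasoning
  open ℕ-Solver

-- The error constant 5 is made up of 3 ≤ 3n from the left-edge offsets and 2n from the two
-- additional tiles per row.
P*hi≤n² : ∀ P n .{{_ : NonZero P}} .{{_ : NonZero n}} →
     P ℕ.* (3 ℕ.+ (2 ℕ.+ n ℕ./ P) ℕ.* n) ℕ.≤ 1 ℕ.* n ℕ.^ 2 ℕ.+ P ℕ.* (5 ℕ.* n)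
P*hi≤n² P n = begin
  P ℕ.* (3 ℕ.+ (2 ℕ.+ n ℕ./ P) ℕ.* n)
    ≤⟨ ℕ.*-monoʳ-≤ P (ℕ.+-monoˡ-≤ ((2 ℕ.+ n ℕ./ P) ℕ.* n) (ℕ.*-monoʳ-≤ 3 (ℕ.>-nonZero⁻¹ n))) ⟩
  P ℕ.* (3 ℕ.* n ℕ.+ (2 ℕ.+ n ℕ./ P) ℕ.* n)
    ≡⟨ solve 3 (λ p m n → p :* (con 3 :* n :+ (con 2 :+ m) :* n) := m :* p :* n :+ p :* (con 5 :* n))
         refl P (n ℕ./ P) n ⟩
  n ℕ./ P ℕ.* P ℕ.* n ℕ.+ P ℕ.* (5 ℕ.* n)
    ≤⟨ ℕ.+-monoˡ-≤ (P ℕ.* (5 ℕ.* n)) (ℕ.*-monoˡ-≤ n (ℕ.m/n*n≤m n P)) ⟩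
  n ℕ.* n ℕ.+ P ℕ.* (5 ℕ.* n)
    ≡⟨ cong (ℕ._+ P ℕ.* (5 ℕ.* n)) (solve 1 (λ n → n :* n := con 1 :* (n :* (n :* con 1))) refl n) ⟩
  1 ℕ.* n ℕ.^ 2 ℕ.+ P ℕ.* (5 ℕ.* n) ∎
  where
  open ℕ.≤-Reasoning
  open ℕ-Solver

-- Both exponents are n²/P up to a multiple of n, and the base is the alphabet size itself, so the
-- entropy comes out as exactly 1/P.
record HasBlockBounds {K : ℕ} (w : Picture K) : Set where
  field
    P        : ℕ
    {{P≢0}}  : NonZero P
    c        : ℕ → ℕ
    count    : ∀ n → BlockCount w n (c n)
    c-≥      : ∀ n → K ℕ.^ (n ℕ./ P ℕ.* n) ℕ.≤ c n
    c-≤      : ∀ n → c n ℕ.≤ K ℕ.^ (3 ℕ.+ (2 ℕ.+ n ℕ./ P) ℕ.* n)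

positive-entropy : ∀ {K} .{{_ : NonTrivial K}} → ∃[ w ] Coverable {K} w × HasBlockBounds w →
                   ∃[ w ] Coverable {K} w × PositiveEntropy w
positive-entropy (w , coverable , bounds) = w , coverable , fromℚ (+ 1 ℚ./ P) ,
  entropy w 1 P 5 (λ n → n ℕ./ P ℕ.* n) (λ n → 3 ℕ.+ (2 ℕ.+ n ℕ./ P) ℕ.* n) c count c-≥ c-≤
    (λ n → n²≤P*lo P n) (λ n → P*hi≤n² P n) ,
  ℚ.<-dense (1/P-positive P)
  where
  open HasBlockBounds bounds
  1/P-positive : ∀ P .{{_ : NonZero P}} → 0ℚᵘ ℚ.< + 1 ℚ./ P
  1/P-positive (suc _) = *<* (ℤ.+<+ (ℕ.s≤s ℕ.z≤n))

universal-bounds : ∀ k → HasBlockBounds (Universal.w k (2 ℕ.+ k))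
universal-bounds k = record
  { P     = P
  ; c     = λ n → length (blocks n)
  ; count = blockCount
  ; c-≥   = blocks-≥
  ; c-≤   = λ n → ℕ.≤-trans (blocks-≤ n) (3*m*m^e≤m^[3+e] (2 ℕ.+ k) ((2 ℕ.+ M n) ℕ.* n) (ℕ.m≤m+n 2 k))
  }
  where open Universal k (2 ℕ.+ k)

proposition1 : (k : ℕ) .{{_ : NonTrivial k}} →
    ((∃[ w ] Coverable {k} w × UniformlyRecurrent w) ×
    (∃[ w ] Coverable {k} w × ¬ UniformlyRecurrent w)) ×
    ((∃[ w ] Coverable {k} w × HasFrequencies w) ×
    (∃[ w ] Coverable {k} w × ¬ HasFrequencies w)) ×
    ((∃[ w ] Coverable {k} w × ZeroEntropy w) ×
    (∃[ w ] Coverable {k} w × PositiveEntropy w))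
proposition1 0 = contradiction (ℕ.nonTrivial⇒n>1 0) λ ()
proposition1 1 = contradiction (ℕ.nonTrivial⇒n>1 1) λ { (ℕ.s≤s ()) }
proposition1 (suc (suc k)) {{k>1}} =
  ((Constant.w blank , Constant.coverable blank , Constant.uniformlyRecurrent blank) ,
   (Stripes.w k , Stripes.coverable k , Stripes.¬uniformlyRecurrent k)) ,
  ((Constant.w blank , Constant.coverable blank , Constant.hasFrequencies blank) ,
   (Stripes.w k , Stripes.coverable k , Stripes.¬hasFrequencies k)) ,
  (zero-entropy {{k>1}} (Constant.w blank , Constant.coverable blank , Constant.blockCount blank) ,
   positive-entropy {{k>1}}
     (Universal.w k (2 ℕ.+ k) , Universal.coverable k (2 ℕ.+ k) , universal-bounds k))
  where
  blank : Fin (2 ℕ.+ k)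
  blank = Fin.zero
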